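{- Let $s\ge 1$. The maximum number of edges of a rooted tree of depth $s$ that is a unit rectangle visibility graph is $$-2+\left(1-\frac{3}{\sqrt{17}}\right)\left(\frac{1}{2}\left(5-\sqrt{17}\right)\right)^s+\left(1+\frac{3}{\sqrt{17}}\right)\left(\frac{1}{2}\left(5+\sqrt{17}\right)\right)^s.$$
   Context: The depth of a rooted tree is the maximum distance from the root to a vertex. A finite simple graph $G$ is a unit rectangle visibility graph (URVG) if its vertices $v$ can be represented by closed unit squares $S_v$ in the plane with sides parallel to the coordinate axes and with pairwise disjoint interiors (squares may touch along their boundaries), in such a way that two distinct vertices $v,w$ are adjacent if and only if there is an unobstructed non-degenerate (positive width) horizontal or vertical band of visibility joining $S_v$ and $S_w$. Here a horizontal band of visibility joining $S_v$ and $S_w$ is given by an open interval $I$ of positive length such that for every $y_0\in I$ the line $y=y_0$ meets the interiors of both $S_v$ and $S_w$, and the part of this line between $S_v$ and $S_w$ (possibly a single point if the squares touch) meets the interior of no other square of the representation; vertical bands are defined analogously with the roles of $x$ and $y$ exchanged. -}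

module Defs where

open import Algebra.Apartness.Structures using (IsHeytingField)
open import Algebra.Bundles using (CommutativeRing; Semiring)
import Algebra.Definitions.RawSemiring as RawSemiringOps
open import Data.Fin.Base using (Fin)
import Data.Fin.Properties as Fin
open import Data.List.Base
  using (List; _∷_; _∷ʳ_; length; filter; allFin; cartesianProduct)
open import Data.List.Relation.Unary.Linked using (Linked)
open import Data.List.Relation.Unary.Unique.Propositional using (Unique)
open import Data.Nat.Base using (ℕ; suc; _≤_)
open import Data.Product.Base using (Σ-syntax; ∃-syntax; _×_; _,_; proj₁; proj₂)
open import Data.Sum.Base using (_⊎_; inj₂)
open import Function.Bundles using (_⇔_)
open import Level using (Level; 0ℓ; _⊔_) renaming (suc to lsuc)
open import Relation.Binary.Core using (Rel)
open import Relation.Binary.Definitions using (Decidable; Symmetric; Irreflexive)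
open import Relation.Binary.PropositionalEquality.Core using (_≡_; _≢_; subst)
open import Relation.Binary.Structures using (IsStrictPartialOrder)
open import Relation.Nullary.Decidable using (_×-dec_)
open import Relation.Nullary.Negation using (¬_)

------------------------------------------------------------------------
-- The real numbers

-- The standard library does not construct ℝ, so it is specified here by its
-- axioms: an Archimedean, Cauchy-complete ordered field.  Classically these
-- characterise ℝ up to unique isomorphism.  They are phrased with a strict
-- order and its apartness, and no decidable trichotomy, so that they also
-- hold of the constructive (Cauchy) reals.
record Reals (c ℓ₁ ℓ₂ : Level) : Set (lsuc (c ⊔ ℓ₁ ⊔ ℓ₂)) where
  infix  8 -_
  infixl 7 _*_
  infixl 6 _+_
  infix  4 _≈_ _<_ _≤ʳ_ _#_

  field
    Carrier : Set c
    _≈_     : Rel Carrier ℓ₁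
    _<_     : Rel Carrier ℓ₂
    _+_     : Carrier → Carrier → Carrier
    _*_     : Carrier → Carrier → Carrier
    -_      : Carrier → Carrier
    0#      : Carrier
    1#      : Carrier

  _#_ : Rel Carrier ℓ₂
  x # y = x < y ⊎ y < x

  _≤ʳ_ : Rel Carrier ℓ₂
  x ≤ʳ y = ¬ (y < x)

  field
    isHeytingField       : IsHeytingField _≈_ _#_ _+_ _*_ -_ 0# 1#
    isStrictPartialOrder : IsStrictPartialOrder _≈_ _<_
    0<1                  : 0# < 1#
    +-monoˡ-<            : ∀ z {x y} → x < y → x + z < y + z
    *-pos                : ∀ {x y} → 0# < x → 0# < y → 0# < x * y

  open IsHeytingField isHeytingField public
    using (isCommutativeRing; #⇒invertible; _-_)

  commutativeRing : CommutativeRing c ℓ₁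
  commutativeRing = record { isCommutativeRing = isCommutativeRing }

  open CommutativeRing commutativeRing using (semiring)
  open RawSemiringOps (Semiring.rawSemiring semiring) public using (_^_) renaming (_×_ to _·_)

  fromℕ : ℕ → Carrier
  fromℕ n = n · 1#

  field
    archimedean : ∀ x → ∃[ n ] x < fromℕ n
    complete    : (f : ℕ → Carrier) →
                  (∀ ε → 0# < ε → ∃[ N ] ∀ m n → N ≤ m → N ≤ n → f m < f n + ε) →
                  ∃[ l ] ∀ ε → 0# < ε →
                    ∃[ N ] ∀ n → N ≤ n → f n < l + ε × l < f n + ε

  -- #⇒invertible applied to 0 < x provides an inverse of x - 0#.
  inverse : ∀ x → 0# < x → Carrier
  inverse x 0<x = proj₁ (#⇒invertible {x} {0#} (inj₂ 0<x))

  0<2 : 0# < fromℕ 2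
  0<2 = <-respʳ-≈ (R.+-congˡ (R.sym (R.+-identityʳ 1#)))
          (<-trans 0<1 (<-respˡ-≈ (R.+-identityˡ 1#) (+-monoˡ-< 1# 0<1)))
    where
    module R = CommutativeRing commutativeRing
    open IsStrictPartialOrder isStrictPartialOrder
      using (<-respʳ-≈; <-respˡ-≈) renaming (trans to <-trans)

  ½ : Carrier
  ½ = inverse (fromℕ 2) 0<2

  closedForm : (√17 : Carrier) → 0# < √17 → ℕ → Carrier
  closedForm √17 0<√17 s =
      (- fromℕ 2)
    + (1# - fromℕ 3 * inverse √17 0<√17) * ((½ * (fromℕ 5 - √17)) ^ s)
    + (1# + fromℕ 3 * inverse √17 0<√17) * ((½ * (fromℕ 5 + √17)) ^ s)

------------------------------------------------------------------------
-- Finite simple graphs and rooted trees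

record Graph (n : ℕ) : Set₁ where
  field
    Adj    : Rel (Fin n) 0ℓ
    adj?   : Decidable Adj
    symm   : Symmetric Adj
    irrefl : Irreflexive _≡_ Adj

module _ {n : ℕ} (G : Graph n) where
  open Graph G

  -- Each edge {v , w} is counted once, as the pair with v < w.
  edgeCount : ℕ
  edgeCount = length (filter (λ e → (proj₁ e Fin.<? proj₂ e) ×-dec adj? (proj₁ e) (proj₂ e))
                             (cartesianProduct (allFin n) (allFin n)))

  data Walk : Fin n → Fin n → ℕ → Set where
    []  : ∀ {v} → Walk v v 0
    _∷_ : ∀ {u v w k} → Adj u v → Walk v w k → Walk u w (suc k)

  Connected : Set
  Connected = ∀ v w → ∃[ k ] Walk v w k

  -- v ∷ vs lists the vertices of a cycle, in order and starting from v.
  IsCycle : Fin n → List (Fin n) → Set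
  IsCycle v vs = 2 ≤ length vs × Unique (v ∷ vs) × Linked Adj (v ∷ (vs ∷ʳ v))

  IsTree : Set
  IsTree = Connected × (∀ v vs → ¬ IsCycle v vs)

  Distance : Fin n → Fin n → ℕ → Set
  Distance v w d = Walk v w d × (∀ k → Walk v w k → d ≤ k)

IsMaximum : ∀ {ℓ} → (ℕ → Set ℓ) → ℕ → Set ℓ
IsMaximum P m = P m × (∀ k → P k → k ≤ m)

Depth : ∀ {n} → Graph n → Fin n → ℕ → Set
Depth G root = IsMaximum (λ d → ∃[ v ] Distance G root v d)

------------------------------------------------------------------------
-- Unit rectangle visibility graphs

module Visibility {c ℓ₁ ℓ₂ : Level} (ℝ : Reals c ℓ₁ ℓ₂) where
  open Reals ℝ

  module _ {n : ℕ} (x y : Fin n → Carrier) where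

    -- The square S_v is [x v , x v + 1] × [y v , y v + 1].
    Interior : Fin n → Carrier → Carrier → Set ℓ₂
    Interior v p q = (x v < p × p < x v + 1#) × (y v < q × q < y v + 1#)

    DisjointInteriors : Set (c ⊔ ℓ₂)
    DisjointInteriors = ∀ v w → v ≢ w → ∀ p q → ¬ (Interior v p q × Interior w p q)

    -- On a line y = q meeting the interiors of both S_v and S_w (which are
    -- disjoint), the points (p , q) between S_v and S_w, endpoints included.
    Between : Fin n → Fin n → Carrier → Set ℓ₂
    Between v w p = (x v + 1# ≤ʳ p × p ≤ʳ x w) ⊎ (x w + 1# ≤ʳ p × p ≤ʳ x v)

    HorizontalBand : Fin n → Fin n → Set (c ⊔ ℓ₂)
    HorizontalBand v w =
      ∃[ a ] ∃[ b ] a < b × (∀ q → a < q → q < b →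
        (∃[ p ] Interior v p q) ×
        (∃[ p ] Interior w p q) ×
        (∀ p → Between v w p → ∀ u → u ≢ v → u ≢ w → ¬ Interior u p q))

  VerticalBand : ∀ {n} (x y : Fin n → Carrier) → Fin n → Fin n → Set (c ⊔ ℓ₂)
  VerticalBand x y = HorizontalBand y x

  IsURVG : ∀ {n} → Graph n → Set (c ⊔ ℓ₂)
  IsURVG {n} G =
    Σ[ x ∈ (Fin n → Carrier) ] Σ[ y ∈ (Fin n → Carrier) ]
      DisjointInteriors x y ×
      (∀ v w → v ≢ w → Graph.Adj G v w ⇔ (HorizontalBand x y v w ⊎ VerticalBand x y v w))

  -- m is the number of edges of some rooted tree of depth s that is a URVG.
  URVGTreeEdges : ℕ → ℕ → Set (lsuc 0ℓ ⊔ c ⊔ ℓ₂)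
  URVGTreeEdges s m =
    ∃[ n ] Σ[ G ∈ Graph n ] Σ[ root ∈ Fin n ]
      IsTree G × Depth G root s × IsURVG G × edgeCount G ≡ m

module Submission where

-- Upper bound.  Along any horizontal line, consecutive squares see each other.
-- If S_u lies between S_v and S_w on one line, every line meeting S_v and S_w
-- also meets S_u: otherwise the tree has a path from v to w avoiding u besides
-- the one through u.  Hence a vertex has at most three neighbours in each
-- direction.  If it has three, two of them lie on one side, shifted up and down
-- (they continue the spine of a row), and the third is aligned on the other side
-- (it starts a leg); from then on each square of the leg has at most one farther
-- neighbour in the row, again aligned.  So with a(d) and b(d) edges below a spine
-- and a leg child, there are at most 2 a(d) + b(d) + 3 edges going down from a
-- vertex within a row not containing its parent, whence
-- a(d+1) = 3 a(d) + 2 b(d) + 5 and b(d+1) = 2 a(d) + 2 b(d) + 4.  Comparisons of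
-- coordinates may be assumed decidable, as the bound itself is a decidable claim.
--
-- Lower bound.  Draw each row of the tree in which all these bounds are attained
-- as a staircase of step ½, with the even squares and their legs to the left and
-- the odd ones to the right, each square farther out than its ancestors; distinct
-- rows are kept far apart.

open import Defs
open import Algebra.Apartness.Structures using (IsHeytingField)
open import Algebra.Bundles using (CommutativeRing)
import Algebra.Properties.AbelianGroup as AbelianGroupProperties
import Algebra.Properties.Ring as RingProperties
import Algebra.Properties.Semiring.Mult as Mult
import Algebra.Solver.Ring.NaturalCoefficients.Default as NaturalCoefficients
open import Data.Bool.Base using (Bool; true; false; not)
open import Data.Bool.Properties using (not-involutive)
open import Data.Empty using (⊥; ⊥-elim)
open import Data.Fin.Base as Fin using (Fin; zero; suc)
import Data.Fin.Properties as Fin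
open import Data.Integer.Base as ℤ using (ℤ; +_; -[1+_]; ∣_∣; 0ℤ; +≤+; -≤+; +<+; -<+; -<-)
import Data.Integer.Properties as ℤ
import Data.Integer.Tactic.RingSolver as ℤSolver
open import Data.List.Base
  using (List; []; _∷_; [_]; _∷ʳ_; _++_; length; map; lookup; replicate; tabulate; concatMap; allFin; cartesianProduct)
import Data.List.Membership.DecPropositional as DecMembership
open import Data.List.Membership.Propositional using (_∈_; find; lose)
open import Data.List.Membership.Propositional.Properties
  using (∈-lookup; ∈-map⁺; ∈-map⁻; ∈-++⁻; ∈-++⁺ˡ; ∈-++⁺ʳ; ∈-concatMap⁺; ∈-concatMap⁻; ∈-filter⁺; ∈-filter⁻; ∈-allFin; ∈-cartesianProduct⁺; ∈-tabulate⁻)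
import Data.List.Properties as List
open import Data.List.Relation.Binary.Disjoint.Propositional using (Disjoint)
open import Data.List.Relation.Unary.All as All using (All; []; _∷_)
import Data.List.Relation.Unary.All.Properties as All
open import Data.List.Relation.Unary.AllPairs as AllPairs using ([]; _∷_)
import Data.List.Relation.Unary.AllPairs.Properties as AllPairs
open import Data.List.Relation.Unary.Any using (here; there; index)
open import Data.List.Relation.Unary.Any.Properties using (lookup-index)
open import Data.List.Relation.Unary.Linked using (Linked; [-]; _∷_)
import Data.List.Relation.Unary.Unique.DecPropositional as DecUnique
open import Data.List.Relation.Unary.Unique.Propositional using (Unique)
import Data.List.Relation.Unary.Unique.Propositional.Properties as Unique
open import Data.Nat.Base as ℕ using (ℕ; zero; suc; _≤_; z≤n; s≤s; s≤s⁻¹)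
import Data.Nat.DivMod as ℕ
open import Data.Nat.ListAction using (sum)
import Data.Nat.Properties as ℕ
open import Data.Nat.Solver using (module +-*-Solver)
open import Data.Nat.Tactic.RingSolver using (solve-∀)
open import Data.Product.Base using (∃-syntax; _×_; _,_; proj₁; proj₂; swap)
open import Data.Product.Properties using (≡-dec)
open import Data.Sum.Base as Sum using (_⊎_; inj₁; inj₂; [_,_]′)
open import Function.Base using (id; _∘_; _$_)
open import Function.Bundles using (Equivalence; mk⇔)
open import Level using (Level; 0ℓ; _⊔_) renaming (suc to lsuc)
open import Relation.Binary.Core using (Rel)
open import Relation.Binary.Definitions using (Decidable; DecidableEquality; tri<; tri≈; tri>)
open import Relation.Binary.PropositionalEquality using (_≡_; _≢_; refl; sym; trans; cong; cong₂; subst; subst₂)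
import Relation.Binary.Reasoning.Setoid as SetoidReasoning
open import Relation.Binary.Structures using (IsStrictPartialOrder)
open import Relation.Nullary using (¬_; Dec; yes; no; contradiction)
open import Relation.Nullary.Decidable
  using (¬¬-excluded-middle; decidable-stable; from-yes; _×-dec_; _⊎-dec_; ¬?)
import Relation.Unary as U

-- The bounds a(d) and b(d) cannot be proved alone: a walk may run along aligned squares and only
-- later meet a vertex with two shifted neighbours ahead. Being full on one side is therefore
-- defined by arbitrary squares on that side, adjacent or not, so that it passes along aligned
-- squares, and a walk towards such a vertex gets only the weak bound 2 a(d). This is enough: a
-- single child with the weak bound costs at most 1 + 2 a(d), less than the 2 (1 + a(d)) granted for
-- two spine children, and a shifted child is never full on its far side.
--
-- Edges are counted as last steps of non-backtracking walks, so no subtrees have to be formed.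
--
-- The pair (a, b) evolves by the matrix with rows (3 2) and (2 2), of trace 5 and determinant 2;
-- this gives X² - 5 X + 2. At the fixed point of the affine recursion the total is -2, the constant
-- term of the closed form.

private variable
  ℓa ℓb ℓp ℓq ℓr : Level
  A : Set ℓa
  B : Set ℓb

-- Walks and cycles

module _ {n : ℕ} (G : Graph n) where
  open Graph G

  data WalkIn {ℓ : Level} (S : Fin n → Set ℓ) : Fin n → Fin n → Set ℓ where
    stay : ∀ {v} → S v → WalkIn S v v
    step : ∀ {u v w} → S u → Adj u v → WalkIn S v w → WalkIn S u w

module _ {n : ℕ} {G : Graph n} where
  open Graph G

  private variable
    ℓ ℓ′ : Level
    S : Fin n → Set ℓ
    T : Fin n → Set ℓ′
    u v w : Fin n

  mapWalk : (∀ {v} → S v → T v) → WalkIn G S u w → WalkIn G T u w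
  mapWalk f (stay s)     = stay (f s)
  mapWalk f (step s e p) = step (f s) e (mapWalk f p)

  infixr 5 _++ʷ_
  _++ʷ_ : WalkIn G S u v → WalkIn G S v w → WalkIn G S u w
  stay _     ++ʷ q = q
  step s e p ++ʷ q = step s e (p ++ʷ q)

  walk-head : WalkIn G S u w → S u
  walk-head (stay s)     = s
  walk-head (step s _ _) = s

  reverseWalk : WalkIn G S u w → WalkIn G S w u
  reverseWalk (stay s)     = stay s
  reverseWalk (step s e p) = reverseWalk p ++ʷ step (walk-head p) (symm e) (stay s)

  -- The part before the first visit to `u` avoids `u`, and its last vertex still satisfies `S`.
  firstArrival : WalkIn G S v u → v ≢ u →
                 ∃[ w ] S w × Adj w u × WalkIn G (_≢ u) v w
  firstArrival (stay _) v≢v = contradiction refl v≢v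
  firstArrival {u = u} (step {v = x} s e p) v≢u with x Fin.≟ u
  ... | yes refl = _ , s , e , stay v≢u
  ... | no x≢u   =
    let w , sw , e′ , q = firstArrival p x≢u in w , sw , e′ , step v≢u e q

  data EndsWith (b : Fin n) : List (Fin n) → Set where
    stop : EndsWith b (b ∷ [])
    later : ∀ {a as} → EndsWith b as → EndsWith b (a ∷ as)

  -- A cycle through `u`, cut open at `u`: `linked` already returns to `u`. An empty `rest` forces
  -- `a ≡ b` by `ends`; otherwise there are enough vertices for a cycle.
  record SimplePath (a b u : Fin n) : Set where
    constructor simplePath
    field
      rest   : List (Fin n)
      ends   : EndsWith b (a ∷ rest)
      linked : Linked Adj (a ∷ (rest ∷ʳ u))
      unique : Unique (a ∷ rest)
      avoids : All (u ≢_) (a ∷ rest)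

  cutAt : ∀ {a b c u} (p : SimplePath c b u) → a ∈ (c ∷ SimplePath.rest p) → SimplePath a b u
  cutAt p (here refl) = p
  cutAt (simplePath (d ∷ ds) (later e) (_ ∷ l) (_ ∷ q) (_ ∷ s)) (there m) =
    cutAt (simplePath ds e l q s) m

  -- Loop erasure: if the new first vertex already occurs on the path, everything before that
  -- occurrence is dropped.
  toSimplePath : ∀ {a b u} → WalkIn G (_≢ u) a b → Adj b u → SimplePath a b u
  toSimplePath (stay a≢u) e =
    simplePath [] stop (e ∷ [-]) ([] ∷ []) ((λ u≡a → a≢u (sym u≡a)) ∷ [])
  toSimplePath {a = a} (step {v = c} a≢u e′ p) e with toSimplePath p e
  ... | q@(simplePath rest ends linked unique avoids)
    with DecMembership._∈?_ Fin._≟_ a (c ∷ rest)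
  ... | yes a∈ = cutAt q a∈
  ... | no  a∉ = simplePath (c ∷ rest) (later ends) (e′ ∷ linked) (All.¬Any⇒All¬ _ a∉ ∷ unique)
                            ((λ u≡a → a≢u (sym u≡a)) ∷ avoids)

  -- A simple path from `a` to `b` that misses `u` closes to a cycle through `u`. Every restriction
  -- on neighbours within a row is derived from this.
  acyclic⇒separates : (∀ v vs → ¬ IsCycle G v vs) →
                      ∀ {u a b} → Adj u a → Adj u b → a ≢ b → ¬ WalkIn G (_≢ u) a b
  acyclic⇒separates acyclic {u} {a} ua ub a≢b p with toSimplePath p (symm ub)
  ... | simplePath []       stop _ _ _ = a≢b refl
  ... | simplePath []       (later ()) _ _ _
  ... | simplePath (c ∷ cs) ends linked unique avoids =
    acyclic u (a ∷ c ∷ cs) (s≤s (s≤s z≤n) , avoids ∷ unique , ua ∷ linked)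

-- The real line

infixl 1 _>>=_
-- Classical case distinctions on reals are made inside the double-negation monad, which is left
-- only where the goal is decidable or absurd.
_>>=_ : ¬ ¬ A → (A → ¬ ¬ B) → ¬ ¬ B
(m >>= f) k = m (λ x → f x k)

return : A → ¬ ¬ A
return x k = k x

¬¬-∀-Fin : ∀ {n} {P : Fin n → Set ℓp} → (∀ i → ¬ ¬ P i) → ¬ ¬ (∀ i → P i)
¬¬-∀-Fin {n = zero}  f = return λ ()
¬¬-∀-Fin {n = suc n} f = do
  p  ← f zero
  ps ← ¬¬-∀-Fin (f ∘ suc)
  return λ { zero → p ; (suc i) → ps i }

module RealOrder {c ℓ₁ ℓ₂} (ℝ : Reals c ℓ₁ ℓ₂) where
  open Reals ℝ public
  module R = CommutativeRing commutativeRing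
  open RingProperties R.ring public using (-‿distribʳ-*; -‿distribˡ-*; -‿involutive)
  open IsStrictPartialOrder isStrictPartialOrder public
    using (<-respʳ-≈; <-respˡ-≈) renaming (trans to <-trans; irrefl to <-irrefl′; asym to <-asym)
  open IsHeytingField isHeytingField public using (tight; #-cotrans)

  private variable
    x y z w : Carrier

  <-irrefl : ¬ (x < x)
  <-irrefl = <-irrefl′ R.refl

  <⇒≤ : x < y → x ≤ʳ y
  <⇒≤ = <-asym

  ≤-refl : x ≤ʳ x
  ≤-refl = <-irrefl

  ≈⇒≤ : x R.≈ y → x ≤ʳ y
  ≈⇒≤ x≈y y<x = <-irrefl′ (R.sym x≈y) y<x

  -- Since `≤ʳ` is merely a negation, the strict inequality has to come from cotransitivity: `z` is
  -- apart from `x` or from `y`.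
  <-≤-trans : x < y → y ≤ʳ z → x < z
  <-≤-trans {z = z} x<y y≤z with #-cotrans (inj₁ x<y) z
  ... | inj₁ (inj₁ x<z) = x<z
  ... | inj₁ (inj₂ z<x) = contradiction (<-trans z<x x<y) y≤z
  ... | inj₂ (inj₁ z<y) = contradiction z<y y≤z
  ... | inj₂ (inj₂ y<z) = <-trans x<y y<z

  ≤-<-trans : x ≤ʳ y → y < z → x < z
  ≤-<-trans {x = x} x≤y y<z with #-cotrans (inj₁ y<z) x
  ... | inj₁ (inj₁ y<x) = contradiction y<x x≤y
  ... | inj₁ (inj₂ x<y) = <-trans x<y y<z
  ... | inj₂ (inj₁ x<z) = x<z
  ... | inj₂ (inj₂ z<x) = contradiction (<-trans y<z z<x) x≤y

  ≤-trans : x ≤ʳ y → y ≤ʳ z → x ≤ʳ z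
  ≤-trans x≤y y≤z z<x = x≤y (≤-<-trans y≤z z<x)

  ≤-total : ∀ x y → ¬ ¬ (x ≤ʳ y ⊎ y ≤ʳ x)
  ≤-total x y k = k (inj₁ λ y<x → k (inj₂ (<-asym y<x)))

  +-monoʳ-< : ∀ z {x y} → x < y → z + x < z + y
  +-monoʳ-< z {x} {y} x<y =
    <-respˡ-≈ (R.+-comm x z) (<-respʳ-≈ (R.+-comm y z) (+-monoˡ-< z x<y))

  +-cancelʳ-< : ∀ z {x y} → x + z < y + z → x < y
  +-cancelʳ-< z lt = <-respˡ-≈ (undo _) (<-respʳ-≈ (undo _) (+-monoˡ-< (- z) lt))
    where
    undo : ∀ w → w + z + - z R.≈ w
    undo w = R.trans (R.+-assoc w z (- z)) (R.trans (R.+-congˡ (R.-‿inverseʳ z)) (R.+-identityʳ w))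

  +-monoˡ-≤ : ∀ z {x y} → x ≤ʳ y → x + z ≤ʳ y + z
  +-monoˡ-≤ z x≤y lt = x≤y (+-cancelʳ-< z lt)

  x<x+pos : ∀ x {y} → 0# < y → x < x + y
  x<x+pos x 0<y = <-respˡ-≈ (R.+-identityʳ x) (+-monoʳ-< x 0<y)

  x<x+1 : ∀ x → x < x + 1#
  x<x+1 x = x<x+pos x 0<1

  inverse-inverseʳ : ∀ x 0<x → x * inverse x 0<x R.≈ 1#
  inverse-inverseʳ x 0<x =
    R.trans (R.*-congʳ (R.sym x-0≈x)) (proj₂ (proj₂ (#⇒invertible {x} {0#} (inj₂ 0<x))))
    where
    x-0≈x : x - 0# R.≈ x
    x-0≈x = R.trans (R.+-congˡ (RingProperties.-0#≈0# R.ring)) (R.+-identityʳ x)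

  ½+½≈1 : ½ + ½ R.≈ 1#
  ½+½≈1 = R.trans (R.sym (R.trans (R.distribʳ ½ 1# (1# + 0#))
                                  (R.+-cong (R.*-identityˡ ½)
                                            (R.trans (R.*-congʳ (R.+-identityʳ 1#)) (R.*-identityˡ ½)))))
                  (inverse-inverseʳ (fromℕ 2) 0<2)

  0<½ : 0# < ½
  0<½ with #-cotrans (inj₁ 0<1) ½
  ... | inj₁ (inj₁ 0<½) = 0<½
  ... | inj₁ (inj₂ ½<0) = contradiction
    (<-trans 0<1 (<-respˡ-≈ ½+½≈1 (<-trans (+-monoˡ-< ½ ½<0) (<-respˡ-≈ (R.sym (R.+-identityˡ ½)) ½<0)))) <-irrefl
  ... | inj₂ (inj₁ ½<1) = +-cancelʳ-< ½ (<-respˡ-≈ (R.sym (R.+-identityˡ ½)) (<-respʳ-≈ (R.sym ½+½≈1) ½<1))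
  ... | inj₂ (inj₂ 1<½) = <-trans 0<1 1<½

  halves : ∀ x → (x + x) * ½ R.≈ x
  halves x = R.trans (R.distribʳ ½ x x) (R.trans (R.sym (R.distribˡ x ½ ½))
               (R.trans (R.*-congˡ ½+½≈1) (R.*-identityʳ x)))

  *½-mono-< : x < y → x * ½ < y * ½
  *½-mono-< {x} {y} x<y =
    +-cancelʳ-< (- (x * ½)) (<-respˡ-≈ (R.sym (R.-‿inverseʳ (x * ½)))
      (<-respʳ-≈ (R.trans (R.distribʳ ½ y (- x)) (R.+-congˡ (R.sym (-‿distribˡ-* x ½))))
        (*-pos (<-respˡ-≈ (R.-‿inverseʳ x) (+-monoˡ-< (- x) x<y)) 0<½)))

  dense : x < y → ∃[ q ] x < q × q < y
  dense {x} {y} x<y =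
    (x + y) * ½ ,
    <-respˡ-≈ (halves x) (*½-mono-< (+-monoʳ-< x x<y)) ,
    <-respʳ-≈ (halves y) (*½-mono-< (+-monoˡ-< y x<y))

  unit-dense : ∀ x → ∃[ p ] x < p × p < x + 1#
  unit-dense x = dense (x<x+1 x)

  unit-overlap : x < y + 1# → y < x + 1# →
                 ¬ ¬ (∃[ p ] (x < p × p < x + 1#) × (y < p × p < y + 1#))
  unit-overlap {x} {y} x<y+1 y<x+1 = do
    inj₁ x≤y ← ≤-total x y
      where inj₂ y≤x → let p , x<p , p<y+1 = dense x<y+1 in
                       return (p , (x<p , <-≤-trans p<y+1 (+-monoˡ-≤ 1# y≤x)) ,
                                   (≤-<-trans y≤x x<p , p<y+1))
    let p , y<p , p<x+1 = dense y<x+1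
    return (p , (≤-<-trans x≤y y<p , p<x+1) ,
                (y<p , <-≤-trans p<x+1 (+-monoˡ-≤ 1# x≤y)))

  -- With the bottom edges as `z`, no square begins strictly between `t` and `b`, so the line just
  -- above `t` stands for the whole strip.
  below-all : ∀ {n} (z : Fin n → Carrier) {t b₀} → t < b₀ →
              ¬ ¬ (∃[ b ] t < b × b ≤ʳ b₀ × (∀ i → t < z i → b ≤ʳ z i))
  below-all {zero}  z {b₀ = b₀} t<b₀ = return (b₀ , t<b₀ , ≤-refl , λ ())
  below-all {suc n} z {t} t<b₀ = do
    b , t<b , b≤b₀ , below ← below-all (z ∘ suc) t<b₀
    yes t<z ← ¬¬-excluded-middle {A = t < z zero}
      where no t≮z → return (b , t<b , b≤b₀ ,
                             λ { zero t<z → contradiction t<z t≮z ; (suc i) → below i })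
    inj₁ b≤z ← ≤-total b (z zero)
      where inj₂ z≤b → return (z zero , t<z , ≤-trans z≤b b≤b₀ ,
                               λ { zero _ → ≤-refl ; (suc i) lt → ≤-trans z≤b (below i lt) })
    return (b , t<b , b≤b₀ , λ { zero _ → b≤z ; (suc i) → below i })

-- Rows of squares

-- The part of the geometry that the counting argument sees, in one of the two
-- directions: v ◁ w says that S_v lies to the left of S_w, and v ⊑ w that the
-- bottom line of S_w meets S_v, i.e. that y_v ≤ y_w < y_v + 1.
record Rows {n : ℕ} (Adj : Rel (Fin n) 0ℓ) (ℓ : Level) : Set (lsuc ℓ) where
  field
    _◁_  : Rel (Fin n) ℓ
    _⊑_  : Rel (Fin n) ℓ
    _◁?_ : Decidable _◁_
    _⊑?_ : Decidable _⊑_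

  Above : Rel (Fin n) ℓ
  Above v w = v ⊑ w × ¬ w ⊑ v

  Aligned : Rel (Fin n) ℓ
  Aligned v w = v ⊑ w × w ⊑ v

  Beside : Rel (Fin n) ℓ
  Beside v w = v ⊑ w ⊎ w ⊑ v

  field
    ◁-trans      : ∀ {u v w} → u ◁ v → v ◁ w → u ◁ w
    sided        : ∀ {v w} → v ≢ w → Beside v w → v ◁ w ⊎ w ◁ v
    alignedˡ     : ∀ {u v w} → Aligned u v → u ⊑ w → v ⊑ w
    alignedʳ     : ∀ {u v w} → Aligned u v → w ⊑ u → w ⊑ v
    upper-right  : ∀ {u v w} → Adj u v → Adj u w → u ◁ v → u ◁ w → u ⊑ v → u ⊑ w → v ≡ w
    upper-left   : ∀ {u v w} → Adj u v → Adj u w → v ◁ u → w ◁ u → u ⊑ v → u ⊑ w → v ≡ w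
    lower-right  : ∀ {u v w} → Adj u v → Adj u w → u ◁ v → u ◁ w → v ⊑ u → w ⊑ u → v ≡ w
    lower-left   : ∀ {u v w} → Adj u v → Adj u w → v ◁ u → w ◁ u → v ⊑ u → w ⊑ u → v ≡ w
    not-both-above : ∀ {u v w} → v ◁ u → u ◁ w → Above u v → Above u w → ⊥
    not-both-below : ∀ {u v w} → v ◁ u → u ◁ w → Above v u → Above w u → ⊥

reflect : ∀ {n ℓ} {Adj : Rel (Fin n) 0ℓ} → Rows Adj ℓ → Rows Adj ℓ
reflect 𝓡 = record
  { _◁_            = λ v w → w ◁ v
  ; _⊑_            = _⊑_
  ; _◁?_           = λ v w → w ◁? v
  ; _⊑?_           = _⊑?_
  ; ◁-trans        = λ u◁v v◁w → ◁-trans v◁w u◁v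
  ; sided          = λ v≢w b → [ inj₂ , inj₁ ]′ (sided v≢w b)
  ; alignedˡ       = alignedˡ
  ; alignedʳ       = alignedʳ
  ; upper-right    = upper-left
  ; upper-left     = upper-right
  ; lower-right    = lower-left
  ; lower-left     = lower-right
  ; not-both-above = λ p q r s → not-both-above q p s r
  ; not-both-below = λ p q r s → not-both-below q p s r
  }
  where open Rows 𝓡

-- Rows of squares whose visibility graph is acyclic

module VisibilityRows
  {c ℓ₁ ℓ₂} (ℝ : Reals c ℓ₁ ℓ₂) {n : ℕ} (G : Graph n)
  (acyclic : ∀ v vs → ¬ IsCycle G v vs)
  (x y : Fin n → Reals.Carrier ℝ)
  (disjoint : Visibility.DisjointInteriors ℝ x y)
  (seen : ∀ v w → v ≢ w → Visibility.HorizontalBand ℝ x y v w → Graph.Adj G v w)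
  where
  open RealOrder ℝ
  open Visibility ℝ
  open Graph G

  infix 4 _◁_ _⊑_
  _◁_ : Rel (Fin n) ℓ₂
  v ◁ w = x v + 1# ≤ʳ x w

  -- The line just above height t meets the interior of S_w.
  Meets : Carrier → Fin n → Set ℓ₂
  Meets t w = y w ≤ʳ t × t < y w + 1#

  _⊑_ : Rel (Fin n) ℓ₂
  v ⊑ w = Meets (y w) v

  ◁-trans : ∀ {u v w} → u ◁ v → v ◁ w → u ◁ w
  ◁-trans u◁v v◁w = ≤-trans u◁v (≤-trans (<⇒≤ (x<x+1 _)) v◁w)

  ◁-irrefl : ∀ {v} → ¬ v ◁ v
  ◁-irrefl v◁v = v◁v (x<x+1 _)

  ◁-asym : ∀ {u v} → u ◁ v → ¬ v ◁ u
  ◁-asym u◁v v◁u = ◁-irrefl (◁-trans u◁v v◁u)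

  ◁⇒≢ : ∀ {u v} → u ◁ v → u ≢ v
  ◁⇒≢ u◁v refl = ◁-irrefl u◁v

  -- If neither is left of the other, the x-intervals overlap; the y-intervals overlap because of
  -- the common line. A common interior point contradicts disjointness.
  ordered : ∀ {t v w} → v ≢ w → Meets t v → Meets t w → ¬ ¬ (v ◁ w ⊎ w ◁ v)
  ordered v≢w (v≤t , t<v+1) (w≤t , t<w+1) k =
    k (inj₁ λ w<v+1 → k (inj₂ λ v<w+1 →
      unit-overlap v<w+1 w<v+1 λ (p , pv , pw) →
      unit-overlap (≤-<-trans v≤t t<w+1) (≤-<-trans w≤t t<v+1) λ (q , qv , qw) →
      disjoint _ _ v≢w p q ((pv , qv) , (pw , qw))))

  consecutive : ∀ {t P Q} → Meets t P → Meets t Q → P ◁ Q →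
                (∀ R → P ◁ R → R ◁ Q → ¬ Meets t R) → ¬ ¬ Adj P Q
  consecutive {t} {P} {Q} (P≤t , t<P+1) (Q≤t , t<Q+1) P◁Q clear = do
    -- The one-element family puts `b₁` below the tops of both `P` and `Q`.
    b₁ , t<b₁ , b₁≤P , b₁≤Q ← below-all {1} (λ _ → y Q + 1#) {t} t<P+1
    b , t<b , b≤b₁ , below ← below-all y t<b₁
    return (seen P Q (◁⇒≢ P◁Q) (t , b , t<b , λ q t<q q<b →
      (let p , p∈ = unit-dense (x P) in
        p , p∈ , ≤-<-trans P≤t t<q , <-≤-trans q<b (≤-trans b≤b₁ b₁≤P)) ,
      (let p , p∈ = unit-dense (x Q) in
        p , p∈ , ≤-<-trans Q≤t t<q , <-≤-trans q<b (≤-trans b≤b₁ (b₁≤Q zero t<Q+1))) ,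
      λ p between u u≢P u≢Q ((u<p , p<u+1) , (u<q , q<u+1)) →
        -- A blocking square cannot begin inside the strip, so it already meets the line just above
        -- `t`.
        let u∈ : Meets t u
            u∈ = (λ t<u → below u t<u (<-trans u<q q<b)) , <-trans t<q q<u+1
        in
        ordered u≢P u∈ (P≤t , t<P+1) λ where
          (inj₁ u◁P) → between-right between
            (λ P+1≤p → <-irrefl (<-≤-trans (<-≤-trans p<u+1 u◁P) (≤-trans (<⇒≤ (x<x+1 _)) P+1≤p)))
          (inj₂ P◁u) → ordered u≢Q u∈ (Q≤t , t<Q+1) λ where
            (inj₁ u◁Q) → clear u P◁u u◁Q u∈
            (inj₂ Q◁u) → between-left between
              (λ p≤Q → <-irrefl (<-≤-trans (<-≤-trans (≤-<-trans Q◁u u<p) p≤Q) (<⇒≤ (x<x+1 _))))))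
    where
    wrong-side : ∀ {p} → ¬ (x Q + 1# ≤ʳ p × p ≤ʳ x P)
    wrong-side (Q+1≤p , p≤P) = ◁-asym P◁Q (≤-trans Q+1≤p p≤P)
    between-right : ∀ {p} → Between x y P Q p → ¬ ¬ (x P + 1# ≤ʳ p)
    between-right (inj₁ (P+1≤p , _)) = return P+1≤p
    between-right (inj₂ wrong)       = contradiction wrong wrong-side
    between-left : ∀ {p} → Between x y P Q p → ¬ ¬ (p ≤ʳ x Q)
    between-left (inj₁ (_ , p≤Q)) = return p≤Q
    between-left (inj₂ wrong)     = contradiction wrong wrong-side

  Span : Carrier → Fin n → Fin n → Fin n → Set ℓ₂
  Span t P Q R = Meets t R × (P ≡ R ⊎ P ◁ R) × (R ≡ Q ⊎ R ◁ Q)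

  -- Induction on a list containing all squares of the line strictly between the ends: each one
  -- found splits the stretch in two, and once none is left the ends are consecutive.
  walkAlong : ∀ {t P Q} → Meets t P → Meets t Q → P ◁ Q → ¬ ¬ WalkIn G (Span t P Q) P Q
  walkAlong {t} P∈ Q∈ P◁Q = go (allFin n) P∈ Q∈ P◁Q (λ R _ _ _ → ∈-allFin R)
    where
    go : ∀ Rs {P Q} → Meets t P → Meets t Q → P ◁ Q →
         (∀ R → P ◁ R → R ◁ Q → Meets t R → R ∈ Rs) → ¬ ¬ WalkIn G (Span t P Q) P Q
    go [] P∈ Q∈ P◁Q all = do
      e ← consecutive P∈ Q∈ P◁Q λ R P◁R R◁Q R∈ → contradiction (all R P◁R R◁Q R∈) λ ()
      return (step (P∈ , inj₁ refl , inj₂ P◁Q) e (stay (Q∈ , inj₂ P◁Q , inj₁ refl)))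
    go (R ∷ Rs) {P} {Q} P∈ Q∈ P◁Q all = do
      yes (P◁R , R◁Q , R∈) ← ¬¬-excluded-middle {A = P ◁ R × R ◁ Q × Meets t R}
        where no not → go Rs P∈ Q∈ P◁Q λ R′ P◁R′ R′◁Q R′∈ →
                case-∈ (all R′ P◁R′ R′◁Q R′∈) (λ { refl → not (P◁R′ , R′◁Q , R′∈) })
      p ← go Rs P∈ R∈ P◁R λ R′ P◁R′ R′◁R R′∈ →
            case-∈ (all R′ P◁R′ (◁-trans R′◁R R◁Q) R′∈) λ { refl → ◁-irrefl R′◁R }
      q ← go Rs R∈ Q∈ R◁Q λ R′ R◁R′ R′◁Q R′∈ →
            case-∈ (all R′ (◁-trans P◁R R◁R′) R′◁Q R′∈) λ { refl → ◁-irrefl R◁R′ }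
      return (mapWalk (λ (m , l , r) → m , l , inj₂ ([ (λ { refl → R◁Q }) , (λ v◁R → ◁-trans v◁R R◁Q) ]′ r)) p
              ++ʷ mapWalk (λ (m , l , r) → m , inj₂ ([ (λ { refl → P◁R }) , (λ R◁v → ◁-trans P◁R R◁v) ]′ l) , r) q)
      where
      case-∈ : ∀ {R′} → R′ ∈ (R ∷ Rs) → ¬ (R′ ≡ R) → R′ ∈ Rs
      case-∈ (here R′≡R) R′≢R = contradiction R′≡R R′≢R
      case-∈ (there R′∈) _    = R′∈

  -- Along the line, P and Q lie on both sides of u; a second connection
  -- from P to Q that bypasses u closes a cycle through u.
  no-bypass : ∀ {t P u Q} → P ◁ u → u ◁ Q → Meets t P → Meets t u → Meets t Q →
              ¬ WalkIn G (_≢ u) P Q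
  no-bypass {t} {P} {u} {Q} P◁u u◁Q P∈ u∈ Q∈ bypass =
    walkAlong P∈ u∈ P◁u λ left → walkAlong u∈ Q∈ u◁Q λ right →
    let u′ , (_ , _ , u′≤u) , e′ , left′ = firstArrival left (◁⇒≢ P◁u)
        u″ , (_ , u≤u″ , _) , e″ , right′ = firstArrival (reverseWalk right) (◁⇒≢ u◁Q ∘ sym)
    in acyclic⇒separates acyclic (symm e′) (symm e″)
         (◁⇒≢ (◁-trans (strictly u′≤u e′) (strictly u≤u″ (symm e″))))
         (reverseWalk left′ ++ʷ bypass ++ʷ right′)
    where
    strictly : ∀ {v w} → v ≡ w ⊎ v ◁ w → Adj v w → v ◁ w
    strictly (inj₁ v≡w) e = contradiction e (irrefl v≡w)
    strictly (inj₂ v◁w) e = v◁w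

  -- If `u` missed the line at `t′`, the walk along that line would be a bypass.
  no-other-line : ∀ {t t′ P u Q} → P ◁ u → u ◁ Q → Meets t P → Meets t u → Meets t Q →
                  Meets t′ P → Meets t′ Q → ¬ ¬ Meets t′ u
  no-other-line P◁u u◁Q P∈ u∈ Q∈ P∈′ Q∈′ u∉′ =
    walkAlong P∈′ Q∈′ (◁-trans P◁u u◁Q) λ p →
    no-bypass P◁u u◁Q P∈ u∈ Q∈ (mapWalk (λ { (v∈ , _) refl → u∉′ v∈ }) p)

  meets-self : ∀ v → Meets (y v) v
  meets-self v = ≤-refl , x<x+1 (y v)

  -- The nearer of two such neighbours stands between `u` and the farther one, but the edge from `u`
  -- to the farther one bypasses it.
  shadow-right : ∀ {t u v w} → Adj u v → Adj u w → u ◁ v → u ◁ w →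
                 Meets t u → Meets t v → Meets t w → v ≡ w
  shadow-right {v = v} {w} uv uw u◁v u◁w u∈ v∈ w∈ = decidable-stable (v Fin.≟ w) λ v≢w →
    ordered v≢w v∈ w∈ λ where
      (inj₁ v◁w) → no-bypass u◁v v◁w u∈ v∈ w∈ (step (◁⇒≢ u◁v) uw (stay (v≢w ∘ sym)))
      (inj₂ w◁v) → no-bypass u◁w w◁v u∈ w∈ v∈ (step (◁⇒≢ u◁w) uv (stay v≢w))

  shadow-left : ∀ {t u v w} → Adj u v → Adj u w → v ◁ u → w ◁ u →
                Meets t u → Meets t v → Meets t w → v ≡ w
  shadow-left {v = v} {w} uv uw v◁u w◁u u∈ v∈ w∈ = decidable-stable (v Fin.≟ w) λ v≢w →
    ordered v≢w v∈ w∈ λ where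
      (inj₁ v◁w) → no-bypass v◁w w◁u v∈ w∈ u∈ (step v≢w (symm uv) (stay (◁⇒≢ w◁u ∘ sym)))
      (inj₂ w◁v) → no-bypass w◁v v◁u w∈ v∈ u∈ (step (v≢w ∘ sym) (symm uw) (stay (◁⇒≢ v◁u ∘ sym)))

  -- The higher of the two bottom edges serves; it is still below the top of `u`.
  common-upper-line : ∀ {u v w} → u ⊑ v → u ⊑ w →
                      ¬ ¬ (∃[ t ] Meets t u × Meets t v × Meets t w)
  common-upper-line {u} {v} {w} u⊑v@(u≤v , v<u+1) u⊑w@(u≤w , w<u+1) = do
    inj₁ v≤w ← ≤-total (y v) (y w)
      where inj₂ w≤v → return (y v , u⊑v , meets-self v , w≤v , <-≤-trans v<u+1 (+-monoˡ-≤ 1# u≤w))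
    return (y w , u⊑w , (v≤w , <-≤-trans w<u+1 (+-monoˡ-≤ 1# u≤v)) , meets-self w)

  above⇒< : ∀ {v w} → v ⊑ w → ¬ w ⊑ v → ¬ ¬ (y v < y w)
  above⇒< (v≤w , w<v+1) w⋢v v≮w = w⋢v (v≮w , ≤-<-trans v≤w (x<x+1 _))

  not-both-above : ∀ {u v w} → v ◁ u → u ◁ w →
                   u ⊑ v × ¬ v ⊑ u → u ⊑ w × ¬ w ⊑ u → ⊥
  not-both-above {u} v◁u u◁w (u⊑v , v⋢u) (u⊑w , w⋢u) =
    common-upper-line u⊑v u⊑w λ (t , u∈ , v∈ , w∈) →
    above⇒< u⊑v v⋢u λ u<v → above⇒< u⊑w w⋢u λ u<w →
    -- The top edge of `u`: both other squares extend above it, while `u` does not meet the line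
    -- just above it.
    no-other-line {t′ = y u + 1#} v◁u u◁w v∈ u∈ w∈
      (<⇒≤ (proj₂ u⊑v) , +-monoˡ-< 1# u<v) (<⇒≤ (proj₂ u⊑w) , +-monoˡ-< 1# u<w)
      λ (_ , u+1<u+1) → <-irrefl u+1<u+1

  not-both-below : ∀ {u v w} → v ◁ u → u ◁ w →
                   v ⊑ u × ¬ u ⊑ v → w ⊑ u × ¬ u ⊑ w → ⊥
  not-both-below {u} {v} {w} v◁u u◁w (v⊑u , u⋢v) (w⊑u , u⋢w) =
    above⇒< v⊑u u⋢v λ v<u → above⇒< w⊑u u⋢w λ w<u →
    -- The second line is the higher of the two bottom edges, which lies below `u`.
    ≤-total (y v) (y w) λ where
      (inj₁ v≤w) → no-other-line v◁u u◁w v⊑u (meets-self u) w⊑u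
                     (v≤w , <-trans w<u (proj₂ v⊑u)) (meets-self w) λ (u≤w , _) → u≤w w<u
      (inj₂ w≤v) → no-other-line v◁u u◁w v⊑u (meets-self u) w⊑u
                     (meets-self v) (w≤v , <-trans v<u (proj₂ w⊑u)) λ (u≤v , _) → u≤v v<u

  rows : Decidable _◁_ → Decidable _⊑_ → Rows Adj ℓ₂
  rows _◁?_ _⊑?_ = record
    { _◁_            = _◁_
    ; _⊑_            = _⊑_
    ; _◁?_           = _◁?_
    ; _⊑?_           = _⊑?_
    ; ◁-trans        = ◁-trans
      ; sided          = λ {v} {w} v≢w beside → decidable-stable (v ◁? w ⊎-dec w ◁? v)
        ([ (λ v⊑w → ordered v≢w v⊑w (meets-self w)) ,
           (λ w⊑v → ordered v≢w (meets-self v) w⊑v) ]′ beside)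
    ; alignedˡ       = λ { ((u≤v , _) , (v≤u , _)) (u≤w , w<u+1) →
                           ≤-trans v≤u u≤w , <-≤-trans w<u+1 (+-monoˡ-≤ 1# u≤v) }
    ; alignedʳ       = λ { ((u≤v , _) , (v≤u , _)) (w≤u , u<w+1) →
                           ≤-trans w≤u u≤v , ≤-<-trans v≤u u<w+1 }
    ; upper-right    = λ {u} {v} {w} uv uw u◁v u◁w u⊑v u⊑w → decidable-stable (v Fin.≟ w) λ v≢w →
        common-upper-line u⊑v u⊑w λ (t , u∈ , v∈ , w∈) →
        v≢w (shadow-right uv uw u◁v u◁w u∈ v∈ w∈)
    ; upper-left     = λ {u} {v} {w} uv uw v◁u w◁u u⊑v u⊑w → decidable-stable (v Fin.≟ w) λ v≢w →
        common-upper-line u⊑v u⊑w λ (t , u∈ , v∈ , w∈) →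
        v≢w (shadow-left uv uw v◁u w◁u u∈ v∈ w∈)
    ; lower-right    = λ {u} uv uw u◁v u◁w → shadow-right uv uw u◁v u◁w (meets-self u)
    ; lower-left     = λ {u} uv uw v◁u w◁u → shadow-left uv uw v◁u w◁u (meets-self u)
    ; not-both-above = not-both-above
    ; not-both-below = not-both-below
    }

  band⇒beside : ∀ {v w} → HorizontalBand x y v w → ¬ ¬ (v ⊑ w ⊎ w ⊑ v)
  band⇒beside {v} {w} (a , b , a<b , inside) =
    let q , a<q , q<b = dense a<b
        (_ , _ , v<q , q<v+1) , (_ , _ , w<q , q<w+1) , _ = inside q a<q q<b
    in do
    inj₁ v≤w ← ≤-total (y v) (y w)
      where inj₂ w≤v → return (inj₂ (w≤v , <-trans v<q q<w+1))
    return (inj₁ (v≤w , <-trans w<q q<v+1))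

-- Counting edges along rows

module Counting where
  open import Data.Nat.Base using (_+_)

  -- Edges below a spine child and below a leg child (with d further levels),
  -- and edges starting at a vertex and going down inside one of its two rows.
  spineEdges legEdges rowEdges : ℕ → ℕ
  spineEdges zero    = 0
  spineEdges (suc d) = (suc (spineEdges d) + suc (legEdges d)) + rowEdges d
  legEdges zero    = 0
  legEdges (suc d) = suc (legEdges d) + rowEdges d
  rowEdges d = (suc (spineEdges d) + suc (spineEdges d)) + suc (legEdges d)

  maxEdges : ℕ → ℕ
  maxEdges zero    = 0
  maxEdges (suc d) = rowEdges d + rowEdges d

  record AtMost {A : Set} (k : ℕ) (P : A → Set ℓp) : Set ℓp where
    constructor atMost
    field
      members : List A
      small   : length members ≤ k
      covers  : ∀ {x} → P x → x ∈ members

  module _ {A : Set} {P : A → Set ℓp} where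

    none-at-all : ∀ {k} → (∀ {x} → ¬ P x) → AtMost k P
    none-at-all ¬P = atMost [] z≤n λ px → contradiction px ¬P

    only : ∀ {k} a → (∀ {x} → P x → x ≡ a) → AtMost (suc k) P
    only a P⊆a = atMost [ a ] (s≤s z≤n) (here ∘ P⊆a)

    weaken : ∀ {j k} → j ≤ k → AtMost j P → AtMost k P
    weaken j≤k (atMost xs small covers) = atMost xs (ℕ.≤-trans small j≤k) covers

    restrict : ∀ {k} {Q : A → Set ℓq} → (∀ {x} → P x → Q x) → AtMost k Q → AtMost k P
    restrict P⊆Q (atMost xs small covers) = atMost xs small (covers ∘ P⊆Q)

    union : ∀ {j k} {Q : A → Set ℓq} {R : A → Set ℓr} → (∀ {x} → P x → Q x ⊎ R x) →
            AtMost j Q → AtMost k R → AtMost (j + k) P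
    union P⊆Q∪R (atMost xs s c) (atMost ys s′ c′) = atMost (xs ++ ys)
      (ℕ.≤-trans (ℕ.≤-reflexive (List.length-++ xs)) (ℕ.+-mono-≤ s s′))
      ([ ∈-++⁺ˡ ∘ c , ∈-++⁺ʳ xs ∘ c′ ]′ ∘ P⊆Q∪R)

  module Unfolding {n : ℕ} (Adj : Rel (Fin n) 0ℓ) where

    -- Non-backtracking walks of length at most d that start at v, having come
    -- from p; e is the last edge.
    mutual
      Reach : ℕ → Fin n → Fin n → Fin n × Fin n → Set
      Reach zero    p v e = ⊥
      Reach (suc d) p v e = ∃[ w ] Adj v w × w ≢ p × Step d v w e

      Step : ℕ → Fin n → Fin n → Fin n × Fin n → Set
      Step d v w e = e ≡ (v , w) ⊎ Reach d v w e

    atMost-step : ∀ {d v w k} → AtMost k (Reach d v w) → AtMost (suc k) (Step d v w)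
    atMost-step = union id (only _ id)

  module Full {n ℓ} {Adj : Rel (Fin n) 0ℓ} (𝓡 : Rows Adj ℓ) where
    open Rows 𝓡

    -- The witnesses need not be neighbours of `v`, which is why the property survives a move to the
    -- right among aligned squares. In `Above` the second square is the higher one.
    FullLeft : Fin n → Set ℓ
    FullLeft v = (∃[ w ] w ◁ v × Above v w) × (∃[ w ] w ◁ v × Above w v)

    above? : Decidable Above
    above? v w = v ⊑? w ×-dec ¬? (w ⊑? v)

    fullLeft? : U.Decidable FullLeft
    fullLeft? v = Fin.any? (λ w → w ◁? v ×-dec above? v w) ×-dec
                  Fin.any? (λ w → w ◁? v ×-dec above? w v)

    fullLeft-transport : ∀ {p v} → p ◁ v → Aligned p v → FullLeft p → FullLeft v
    fullLeft-transport p◁v al ((w , w◁p , p⊑w , w⋢p) , (u , u◁p , u⊑p , p⋢u)) =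
      (w , ◁-trans w◁p p◁v , alignedˡ al p⊑w , w⋢p ∘ alignedʳ (swap al)) ,
      (u , ◁-trans u◁p p◁v , alignedʳ al u⊑p , p⋢u ∘ alignedˡ (swap al))

    -- If `w` were shifted, it and the square on the left shifted in the same sense would be both
    -- above or both below `v`.
    fullLeft⇒aligned : ∀ {v w} → FullLeft v → v ◁ w → Beside v w → Aligned v w
    fullLeft⇒aligned {v} {w} ((p , p◁v , ↑) , (q , q◁v , ↓)) v◁w b with v ⊑? w | w ⊑? v
    ... | yes v⊑w | yes w⊑v = v⊑w , w⊑v
    ... | yes v⊑w | no  w⋢v = ⊥-elim (not-both-above p◁v v◁w ↑ (v⊑w , w⋢v))
    ... | no  v⋢w | yes w⊑v = ⊥-elim (not-both-below q◁v v◁w ↓ (w⊑v , v⋢w))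
    ... | no  v⋢w | no  w⋢v = ⊥-elim ([ v⋢w , w⋢v ]′ b)

    beside-sym : ∀ {v w} → Beside v w → Beside w v
    beside-sym = [ inj₂ , inj₁ ]′

  module Children {n ℓ} {Adj : Rel (Fin n) 0ℓ} (adj? : Decidable Adj) (𝓡 : Rows Adj ℓ) where
    open Rows 𝓡
    open Full 𝓡 public
    open Full (reflect 𝓡) public using () renaming
      ( FullLeft to FullRight; fullLeft? to fullRight?
      ; fullLeft-transport to fullRight-transport; fullLeft⇒aligned to fullRight⇒aligned )
    open Unfolding Adj

    Right : Rel (Fin n) ℓ
    Right v w = Adj v w × Beside v w × v ◁ w

    data RightView (v : Fin n) : Set ℓ where
      none : (∀ {w} → ¬ Right v w) → RightView v
      one  : ∀ w₁ → Right v w₁ → (∀ {w} → Right v w → w ≡ w₁) → RightView v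
      two  : ∀ w₁ w₂ → Right v w₁ → Right v w₂ → Above v w₁ → Above w₂ v →
             (∀ {w} → Right v w → w ≡ w₁ ⊎ w ≡ w₂) → RightView v

    -- A right neighbour has its bottom line met by `v`, or meets the bottom line of `v`. Each kind
    -- occurs at most once, and a neighbour of both kinds is the only one.
    rightView : ∀ v → RightView v
    rightView v with Fin.any? (λ w → adj? v w ×-dec v ◁? w ×-dec v ⊑? w)
                   | Fin.any? (λ w → adj? v w ×-dec v ◁? w ×-dec w ⊑? v)
    ... | no ¬up | no ¬down = none λ where
      (e , inj₁ v⊑w , v◁w) → ¬up (_ , e , v◁w , v⊑w)
      (e , inj₂ w⊑v , v◁w) → ¬down (_ , e , v◁w , w⊑v)
    ... | yes (w₁ , e₁ , l₁ , u₁) | no ¬down = one w₁ (e₁ , inj₁ u₁ , l₁) λ where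
      (e , inj₁ v⊑w , v◁w) → upper-right e e₁ v◁w l₁ v⊑w u₁
      (e , inj₂ w⊑v , v◁w) → contradiction (_ , e , v◁w , w⊑v) ¬down
    ... | no ¬up | yes (w₂ , e₂ , l₂ , u₂) = one w₂ (e₂ , inj₂ u₂ , l₂) λ where
      (e , inj₁ v⊑w , v◁w) → contradiction (_ , e , v◁w , v⊑w) ¬up
      (e , inj₂ w⊑v , v◁w) → lower-right e e₂ v◁w l₂ w⊑v u₂
    ... | yes (w₁ , e₁ , l₁ , u₁) | yes (w₂ , e₂ , l₂ , u₂) = view (w₁ ⊑? v) (v ⊑? w₂)
      where
      both : ∀ {w} → Right v w → w ≡ w₁ ⊎ w ≡ w₂
      both (e , inj₁ v⊑w , v◁w) = inj₁ (upper-right e e₁ v◁w l₁ v⊑w u₁)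
      both (e , inj₂ w⊑v , v◁w) = inj₂ (lower-right e e₂ v◁w l₂ w⊑v u₂)
      view : Dec (w₁ ⊑ v) → Dec (v ⊑ w₂) → RightView v
      view (yes w₁⊑v) _ = one w₂ (e₂ , inj₂ u₂ , l₂)
        ([ (λ { refl → lower-right e₁ e₂ l₁ l₂ w₁⊑v u₂ }) , id ]′ ∘ both)
      view (no _) (yes v⊑w₂) = one w₁ (e₁ , inj₁ u₁ , l₁)
        ([ id , (λ { refl → upper-right e₂ e₁ l₂ l₁ v⊑w₂ u₁ }) ]′ ∘ both)
      view (no w₁⋢v) (no v⋢w₂) =
        two w₁ w₂ (e₁ , inj₁ u₁ , l₁) (e₂ , inj₂ u₂ , l₂) (u₁ , w₁⋢v) (u₂ , v⋢w₂) both

    two⇒fullRight : ∀ {v w₁ w₂} → Right v w₁ → Right v w₂ → Above v w₁ → Above w₂ v → FullRight v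
    two⇒fullRight (_ , _ , l₁) (_ , _ , l₂) ↑ ↓ = (_ , l₁ , ↑) , (_ , l₂ , ↓)

    above⇒¬fullRight : ∀ {v w} → v ◁ w → Above v w → ¬ FullRight w
    above⇒¬fullRight v◁w ↑ (_ , (u , w◁u , ↓)) = not-both-below v◁w w◁u ↑ ↓

    below⇒¬fullRight : ∀ {v w} → v ◁ w → Above w v → ¬ FullRight w
    below⇒¬fullRight v◁w ↓ ((u , w◁u , ↑) , _) = not-both-above v◁w w◁u ↓ ↑

    fullRight-back : ∀ {v w} → v ◁ w → Beside v w → FullRight w → FullRight v
    fullRight-back v◁w b full =
      fullRight-transport v◁w (fullRight⇒aligned full v◁w (beside-sym b)) full

    -- If FullLeft p, all squares to the right of p are aligned with it, and the
    -- edge from p to v starts a leg.  If FullRight v, the aligned row from p to v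
    -- branches farther right; the weak third bound suffices for such v.
    Bound : ℕ → Set ℓ
    Bound d = ∀ p v → Right p v →
      (FullLeft p → AtMost (legEdges d) (Reach d p v)) ×
      (¬ FullRight v → AtMost (spineEdges d) (Reach d p v)) ×
      AtMost (spineEdges d + spineEdges d) (Reach d p v)

    RightSteps : ℕ → Fin n → Fin n × Fin n → Set ℓ
    RightSteps d v e = ∃[ w ] Right v w × Step d v w e

    module _ {d : ℕ} (bound : Bound d) {v : Fin n} where
      private
        leg-step : ∀ {w} → Right v w → FullLeft v → AtMost (suc (legEdges d)) (Step d v w)
        leg-step vw full = atMost-step (proj₁ (bound v _ vw) full)

        spine-step : ∀ {w} → Right v w → ¬ FullRight w → AtMost (suc (spineEdges d)) (Step d v w)
        spine-step vw ¬full = atMost-step (proj₁ (proj₂ (bound v _ vw)) ¬full)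

        any-step : ∀ {w} → Right v w → AtMost (suc (spineEdges d + spineEdges d)) (Step d v w)
        any-step vw = atMost-step (proj₂ (proj₂ (bound v _ vw)))

      rightSteps-leg : FullLeft v → AtMost (suc (legEdges d)) (RightSteps d v)
      rightSteps-leg full with rightView v
      ... | none ¬r = none-at-all λ (_ , vw , _) → ¬r vw
      ... | one w₁ vw₁ unique =
        restrict (λ { (_ , vw , s) → subst (λ w → Step d v w _) (unique vw) s }) (leg-step vw₁ full)
      ... | two w₁ w₂ (_ , b , v◁w₁) _ (_ , w₁⋢v) _ _ =
        contradiction (proj₂ (fullLeft⇒aligned full v◁w₁ b)) w₁⋢v

      rightSteps-spine : ¬ FullRight v → AtMost (suc (spineEdges d)) (RightSteps d v)
      rightSteps-spine ¬full with rightView v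
      ... | none ¬r = none-at-all λ (_ , vw , _) → ¬r vw
      ... | one w₁ vw₁@(_ , b , v◁w₁) unique =
        restrict (λ { (_ , vw , s) → subst (λ w → Step d v w _) (unique vw) s })
                 (spine-step vw₁ (¬full ∘ fullRight-back v◁w₁ b))
      ... | two w₁ w₂ vw₁ vw₂ ↑ ↓ _ = contradiction (two⇒fullRight vw₁ vw₂ ↑ ↓) ¬full

      rightSteps-any : AtMost (suc (spineEdges d) + suc (spineEdges d)) (RightSteps d v)
      rightSteps-any with rightView v
      ... | none ¬r = none-at-all λ (_ , vw , _) → ¬r vw
      ... | one w₁ vw₁ unique =
        restrict (λ { (_ , vw , s) → subst (λ w → Step d v w _) (unique vw) s })
                 (weaken (s≤s (ℕ.+-monoʳ-≤ (spineEdges d) (ℕ.n≤1+n _))) (any-step vw₁))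
      ... | two w₁ w₂ vw₁@(_ , _ , l₁) vw₂@(_ , _ , l₂) ↑ ↓ both =
        union (λ { (w , vw , s) → [ (λ { refl → inj₁ s }) , (λ { refl → inj₂ s }) ]′ (both vw) })
              (spine-step vw₁ (above⇒¬fullRight l₁ ↑))
              (spine-step vw₂ (below⇒¬fullRight l₂ ↓))

      -- For walks that enter `v` from one of two shifted neighbours and leave by the other; the
      -- latter is not full on its far side.
      rightSteps-onward : ∀ {p} → Right v p → AtMost (suc (spineEdges d))
        (λ e → ∃[ w ] Right v w × w ≢ p × Step d v w e)
      rightSteps-onward {p} vp with rightView v
      ... | none ¬r = none-at-all λ (_ , vw , _) → ¬r vw
      ... | one w₁ vw₁ unique = none-at-all λ (_ , vw , w≢p , _) → w≢p (trans (unique vw) (sym (unique vp)))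
      ... | two w₁ w₂ vw₁@(_ , _ , l₁) vw₂@(_ , _ , l₂) ↑ ↓ both with both vp
      ...   | inj₁ refl = restrict
        (λ { (w , vw , w≢p , s) → [ (λ w≡p → contradiction w≡p w≢p) , (λ { refl → s }) ]′ (both vw) })
        (spine-step vw₂ (below⇒¬fullRight l₂ ↓))
      ...   | inj₂ refl = restrict
        (λ { (w , vw , w≢p , s) → [ (λ { refl → s }) , (λ w≡p → contradiction w≡p w≢p) ]′ (both vw) })
        (spine-step vw₁ (above⇒¬fullRight l₁ ↑))

    only-right-back : ∀ {v p w} → ¬ FullRight v → Right v p → Right v w → w ≡ p
    only-right-back {v} ¬full vp vw with rightView v
    ... | none ¬r = contradiction vp ¬r
    ... | one _ _ unique = trans (unique vw) (sym (unique vp))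
    ... | two w₁ w₂ vw₁ vw₂ ↑ ↓ _ = contradiction (two⇒fullRight vw₁ vw₂ ↑ ↓) ¬full

    aligned-only : ∀ {v p w} → Aligned v p → Right v p → Right v w → w ≡ p
    aligned-only (v⊑p , p⊑v) (vp , _ , v◁p) (vw , inj₁ v⊑w , v◁w) = upper-right vw vp v◁w v◁p v⊑w v⊑p
    aligned-only (v⊑p , p⊑v) (vp , _ , v◁p) (vw , inj₂ w⊑v , v◁w) = lower-right vw vp v◁w v◁p w⊑v p⊑v

  module Induction {n ℓ} {Adj : Rel (Fin n) 0ℓ} (adj? : Decidable Adj)
                   (symmetric : ∀ {v w} → Adj v w → Adj w v)
                   (loopless : ∀ {v w} → Adj v w → v ≢ w)
                   (𝓡 : Rows Adj ℓ) where
    open Rows 𝓡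
    open Unfolding Adj
    private
      module Rt = Children adj? 𝓡
      module Lt = Children adj? (reflect 𝓡)
    open Rt using (FullLeft; FullRight; Right)

    RowSteps : ℕ → Fin n → Fin n × Fin n → Set ℓ
    RowSteps d v e = ∃[ w ] Adj v w × Beside v w × Step d v w e

    row-steps : ∀ {d} → Rt.Bound d → Lt.Bound d → ∀ v → AtMost (rowEdges d) (RowSteps d v)
    row-steps {d} right left v = restrict sides (cases (Rt.fullLeft? v) (Rt.fullRight? v))
      where
      Sides : Fin n × Fin n → Set ℓ
      Sides e = Lt.RightSteps d v e ⊎ Rt.RightSteps d v e
      sides : ∀ {e} → RowSteps d v e → Sides e
      sides (w , vw , b , s) with sided (loopless vw) b
      ... | inj₁ v◁w = inj₂ (w , (vw , b , v◁w) , s)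
      ... | inj₂ w◁v = inj₁ (w , (vw , b , w◁v) , s)
      cases : Dec (FullLeft v) → Dec (FullRight v) → AtMost (rowEdges d) Sides
      cases (yes full) _ = union id (Lt.rightSteps-any left) (Rt.rightSteps-leg right full)
      cases (no _) (yes full) = union [ inj₂ , inj₁ ]′ (Rt.rightSteps-any right) (Lt.rightSteps-leg left full)
      -- With neither side full there is at most one neighbour on each, and two spine children stay
      -- within the row bound.
      cases (no ¬fullˡ) (no ¬fullʳ) = weaken (ℕ.m≤m+n _ _)
        (union id (Lt.rightSteps-spine left ¬fullˡ) (Rt.rightSteps-spine right ¬fullʳ))

    bound-zero : Rt.Bound 0
    bound-zero p v _ = (λ _ → none-at-all id) , (λ _ → none-at-all id) , none-at-all id

    -- From `v` the walk goes on to the right, turns back past `p` to the left, or leaves the row.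
    -- `Cross` abstracts the last case, so the same step serves both directions and their mirror
    -- images.
    bound-suc : ∀ {d} → Rt.Bound d → Lt.Bound d → ∀ {ℓ′} {Cross : Fin n → Fin n × Fin n → Set ℓ′} →
                (∀ {v w e} → Adj v w → Step d v w e → Beside v w ⊎ Cross v e) →
                (∀ v → AtMost (rowEdges d) (Cross v)) → Rt.Bound (suc d)
    bound-suc {d} right left {Cross = Cross} split cross p v pv@(e , b , p◁v) =
      asLeg , asSpine , either
      where
      Back : Fin n × Fin n → Set ℓ
      Back e = ∃[ w ] Lt.Right v w × w ≢ p × Step d v w e
      vp : Lt.Right v p
      vp = symmetric e , Rt.beside-sym b , p◁v
      sides : ∀ {e} → Reach (suc d) p v e → (Rt.RightSteps d v e ⊎ Back e) ⊎ Cross v e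
      sides (w , vw , w≢p , s) with split vw s
      ... | inj₂ c = inj₂ c
      ... | inj₁ beside with sided (loopless vw) beside
      ...   | inj₁ v◁w = inj₁ (inj₁ (w , (vw , beside , v◁w) , s))
      ...   | inj₂ w◁v = inj₁ (inj₂ (w , (vw , beside , w◁v) , w≢p , s))
      aligned-back : Aligned p v → ∀ {e} → ¬ Back e
      aligned-back al (w , vw , w≢p , _) = w≢p (Lt.aligned-only (swap al) vp vw)
      forward : ∀ {k} → (∀ {e} → ¬ Back e) → AtMost k (Rt.RightSteps d v) →
                AtMost (k + rowEdges d) (Reach (suc d) p v)
      forward ¬back steps = union sides
        (restrict [ id , (λ back → contradiction back ¬back) ]′ steps) (cross v)
      asLeg : FullLeft p → AtMost (legEdges (suc d)) (Reach (suc d) p v)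
      asLeg full = forward (aligned-back al) (Rt.rightSteps-leg right (Rt.fullLeft-transport p◁v al full))
        where al = Rt.fullLeft⇒aligned full p◁v b
      asSpine : ¬ FullRight v → AtMost (spineEdges (suc d)) (Reach (suc d) p v)
      asSpine ¬full with Rt.fullLeft? v
      -- Full on the side of `p`: the walk may turn back to the other shifted neighbour there, and
      -- only a leg lies ahead.
      ... | yes full = union sides
        (union [ inj₂ , inj₁ ]′ (Lt.rightSteps-onward left vp) (Rt.rightSteps-leg right full)) (cross v)
      ... | no ¬fullˡ = weaken (ℕ.+-monoˡ-≤ (rowEdges d) (ℕ.m≤m+n (suc (spineEdges d)) (suc (legEdges d))))
        (forward (λ (w , vw , w≢p , _) → w≢p (Lt.only-right-back ¬fullˡ vp vw))
                 (Rt.rightSteps-spine right ¬full))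
      double : (suc (spineEdges d) + suc (spineEdges d)) + rowEdges d ≤
               spineEdges (suc d) + spineEdges (suc d)
      double = ℕ.≤-trans (ℕ.m≤m+n _ (suc (legEdges d) + (suc (legEdges d) + rowEdges d)))
        (ℕ.≤-reflexive (regroup (suc (spineEdges d)) (suc (legEdges d)) (rowEdges d)))
        where
        regroup : ∀ a b c → ((a + a) + c) + (b + (b + c)) ≡ ((a + b) + c) + ((a + b) + c)
        regroup = solve-∀
      either : AtMost (spineEdges (suc d) + spineEdges (suc d)) (Reach (suc d) p v)
      either with Rt.fullRight? v
      ... | no ¬full = weaken (ℕ.m≤m+n _ _) (asSpine ¬full)
      ... | yes full = weaken double (forward (aligned-back al) (Rt.rightSteps-any right))
        where al = swap (Rt.fullRight⇒aligned full p◁v (Rt.beside-sym b))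

  module TwoDirections {n ℓ} {Adj : Rel (Fin n) 0ℓ} (adj? : Decidable Adj)
                       (symmetric : ∀ {v w} → Adj v w → Adj w v)
                       (loopless : ∀ {v w} → Adj v w → v ≢ w)
                       (𝓗 𝓥 : Rows Adj ℓ)
                       (split : ∀ {v w} → Adj v w → Rows.Beside 𝓗 v w ⊎ Rows.Beside 𝓥 v w) where
    open Unfolding Adj
    private
      module H = Induction adj? symmetric loopless 𝓗
      module H′ = Induction adj? symmetric loopless (reflect 𝓗)
      module V = Induction adj? symmetric loopless 𝓥
      module V′ = Induction adj? symmetric loopless (reflect 𝓥)

      Bounds : ℕ → Set ℓ
      Bounds d = (Children.Bound adj? 𝓗 d × Children.Bound adj? (reflect 𝓗) d) ×
                 (Children.Bound adj? 𝓥 d × Children.Bound adj? (reflect 𝓥) d)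

      bounds : ∀ d → Bounds d
      bounds zero    = (H.bound-zero , H′.bound-zero) , (V.bound-zero , V′.bound-zero)
      bounds (suc d) with bounds d
      ... | (h , h′) , (v , v′) =
        (H.bound-suc h h′ hv vertical , H′.bound-suc h′ h hv vertical) ,
        (V.bound-suc v v′ vh horizontal , V′.bound-suc v′ v vh horizontal)
        where
        horizontal = H.row-steps h h′
        vertical = V.row-steps v v′
        hv : ∀ {v w e} → Adj v w → Step d v w e → Rows.Beside 𝓗 v w ⊎ V.RowSteps d v e
        hv vw s = [ inj₁ , (λ b → inj₂ (_ , vw , b , s)) ]′ (split vw)
        vh : ∀ {v w e} → Adj v w → Step d v w e → Rows.Beside 𝓥 v w ⊎ H.RowSteps d v e
        vh vw s = [ (λ b → inj₂ (_ , vw , b , s)) , inj₁ ]′ (split vw)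

    edges-from : ∀ d root → AtMost (maxEdges (suc d)) (λ e → ∃[ w ] Adj root w × Step d root w e)
    edges-from d root with bounds d
    ... | (h , h′) , (v , v′) = union
      (λ { (w , vw , s) → [ (λ b → inj₁ (w , vw , b , s)) , (λ b → inj₂ (w , vw , b , s)) ]′ (split vw) })
      (H.row-steps h h′ root) (V.row-steps v v′ root)

open Counting

-- The upper bound

lookup-unique : ∀ {xs : List A} → Unique xs →
                ∀ {i j} → lookup xs i ≡ lookup xs j → i ≡ j
lookup-unique (_ ∷ _) {zero}  {zero}  _  = refl
lookup-unique (x∉ ∷ _) {zero}  {suc j} eq = contradiction eq (All.lookup x∉ (∈-lookup j))
lookup-unique (x∉ ∷ _) {suc i} {zero}  eq = contradiction (sym eq) (All.lookup x∉ (∈-lookup i))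
lookup-unique (_ ∷ u) {suc i} {suc j} eq = cong suc (lookup-unique u eq)

unique-⊆⇒length≤ : ∀ {xs ys : List A} → Unique xs →
                   (∀ {x} → x ∈ xs → x ∈ ys) → length xs ≤ length ys
unique-⊆⇒length≤ {xs = xs} {ys} unique sub = Fin.injective⇒≤ {f = place} λ {i} {j} eq →
  lookup-unique unique (trans (found i) (trans (cong (lookup ys) eq) (sym (found j))))
  where
  place : Fin (length xs) → Fin (length ys)
  place i = index (sub (∈-lookup {xs = xs} i))
  found : ∀ i → lookup xs i ≡ lookup ys (place i)
  found i = lookup-index (sub (∈-lookup {xs = xs} i))

module Shortest {n} (G : Graph n) where
  open Graph G
  open Unfolding Adj

  shortest : ∀ {k u w} → Walk G u w k → ¬ ¬ (∃[ d ] Distance G u w d)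
  shortest {k} {u} {w} = bounded k ℕ.≤-refl
    where
    bounded : ∀ k {j} → j ≤ k → Walk G u w j → ¬ ¬ (∃[ d ] Distance G u w d)
    bounded k       {zero}  _         p = return (0 , p , λ _ _ → z≤n)
    bounded (suc k) {suc j} (s≤s j≤k) p = do
      yes (i , i≤j , q) ← ¬¬-excluded-middle {A = ∃[ i ] i ≤ j × Walk G u w i}
        where no none → return (suc j , p , λ i q → ℕ.≰⇒> λ i≤j → none (i , i≤j , q))
      bounded k (ℕ.≤-trans i≤j j≤k) q

  avoids : ∀ {u v w k} → Walk G u v k → (∀ j → Walk G u w j → k ≤ j) → v ≢ w →
           WalkIn G (_≢ w) u v
  avoids []      far v≢w = stay v≢w
  avoids (e ∷ p) far v≢w =
    step (λ { refl → contradiction (far 0 []) λ () }) e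
         (avoids p (λ j q → s≤s⁻¹ (far (suc j) (e ∷ q))) v≢w)

  reach-mono : ∀ {j d} → j ≤ d → ∀ {p v e} → Reach j p v e → Reach d p v e
  step-mono  : ∀ {j d} → j ≤ d → ∀ {v w e} → Step j v w e → Step d v w e
  reach-mono {suc j} {suc d} (s≤s j≤d) (w , vw , w≢p , s) = w , vw , w≢p , step-mono j≤d s
  step-mono j≤d (inj₁ eq) = inj₁ eq
  step-mono j≤d (inj₂ r)  = inj₂ (reach-mono j≤d r)

  -- A shortest walk does not backtrack, since removing the detour would shorten it. So it belongs
  -- to the unfolding, where its last edge is counted.
  last-edge : ∀ k {u w} → Walk G u w (suc k) → (∀ j → Walk G u w j → suc k ≤ j) →
              ∃[ v ] ∃[ x ] Adj v w × WalkIn G (_≢ w) u v ×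
                            Adj u x × Step k u x (v , w) × Walk G x w k
  last-edge zero {u} {w} (e ∷ []) min =
    u , w , e , stay (λ { refl → contradiction (min 0 []) λ () }) , e , inj₁ refl , []
  last-edge (suc k) {u} {w} (_∷_ {v = x} e p) min
    with last-edge k p (λ j q → s≤s⁻¹ (min (suc j) (e ∷ q)))
  ... | v , x′ , vw , q , e′ , s , r =
    v , x , vw , step (λ { refl → contradiction (min 0 []) λ () }) e q ,
    e , inj₂ (x′ , e′ , (λ { refl → contradiction (min k r) (ℕ.<⇒≱ (ℕ.m≤n⇒m≤1+n (ℕ.n<1+n k))) }) , s) , p

upward : ∀ {n} → Fin n × Fin n → Fin n × Fin n
upward (v , w) with v Fin.<? w
... | yes _ = v , w
... | no  _ = w , v

upward-id : ∀ {n} {v w : Fin n} → v Fin.< w → upward (v , w) ≡ (v , w)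
upward-id {v = v} {w} v<w with v Fin.<? w
... | yes _  = refl
... | no v≮w = contradiction v<w v≮w

upward-swap : ∀ {n} {v w : Fin n} → v Fin.< w → upward (w , v) ≡ (v , w)
upward-swap {v = v} {w} v<w with w Fin.<? v
... | yes w<v = contradiction w<v (Fin.<-asym v<w)
... | no _    = refl

module _ {n} (G : Graph n) where
  open Graph G

  length≤edgeCount : ∀ {es} → Unique es →
    (∀ {e} → e ∈ es → proj₁ e Fin.< proj₂ e × Adj (proj₁ e) (proj₂ e)) → length es ≤ edgeCount G
  length≤edgeCount unique counted = unique-⊆⇒length≤ unique λ e∈ →
    ∈-filter⁺ (λ e → (proj₁ e Fin.<? proj₂ e) ×-dec adj? (proj₁ e) (proj₂ e))
      (∈-cartesianProduct⁺ (∈-allFin _) (∈-allFin _)) (counted e∈)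

module _ {n} (G : Graph n) (root : Fin n) (d : ℕ) (tree : IsTree G)
         (depth : ∀ k → ∃[ v ] Distance G root v k → k ≤ suc d) where
  open Graph G
  open Unfolding Adj
  open Shortest G

  private
    Unfolded : Fin n × Fin n → Set
    Unfolded e = ∃[ w ] Adj root w × Step d root w e

    -- If a shortest walk to `w` arrived from another neighbour `v′`, then `v` and `v′` would be
    -- joined through the root without meeting `w`.
    towards : ∀ {v w a b} → Adj v w → Distance G root v a → Distance G root w b → a ≤ b →
              Unfolded (v , w)
    towards {b = zero}  vw ([] , _) ([] , _) z≤n = contradiction vw (irrefl refl)
    towards {v} {w} {b = suc k} vw (p , _) (q , min) a≤b with last-edge k q min
    ... | v′ , x , v′w , q′ , e , s , _ with v Fin.≟ v′
    ...   | yes refl = x , e , step-mono (s≤s⁻¹ (depth (suc k) (w , q , min))) s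
    ...   | no v≢v′ = contradiction
      (reverseWalk (avoids p (λ j r → ℕ.≤-trans a≤b (min j r)) λ v≡w → irrefl v≡w vw) ++ʷ q′)
      (acyclic⇒separates (proj₂ tree) (symm vw) (symm v′w) v≢v′)

  every-edge-unfolds : ∀ {v w} → Adj v w → ¬ ¬ (Unfolded (v , w) ⊎ Unfolded (w , v))
  every-edge-unfolds {v} {w} vw = do
    a , dv ← shortest (proj₂ (proj₁ tree root v))
    b , dw ← shortest (proj₂ (proj₁ tree root w))
    return ([ (λ a≤b → inj₁ (towards vw dv dw a≤b)) ,
              (λ b≤a → inj₂ (towards (symm vw) dw dv b≤a)) ]′ (ℕ.≤-total a b))

  edgeCount-bound : ∀ {k} → AtMost k Unfolded → edgeCount G ≤ k
  edgeCount-bound (atMost es small covers) = ℕ.≤-trans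
    (unique-⊆⇒length≤ (Unique.filter⁺ _ (Unique.cartesianProduct⁺ (Unique.allFin⁺ n) (Unique.allFin⁺ n)))
                      (listed ∘ proj₂ ∘ ∈-filter⁻ _ {xs = cartesianProduct (allFin n) (allFin n)}))
    (ℕ.≤-trans (ℕ.≤-reflexive (List.length-map upward es)) small)
    where
    listed : ∀ {e} → proj₁ e Fin.< proj₂ e × Adj (proj₁ e) (proj₂ e) → e ∈ map upward es
    listed {v , w} (v<w , vw) =
      decidable-stable (DecMembership._∈?_ (≡-dec Fin._≟_ Fin._≟_) (v , w) (map upward es)) λ ∉ →
      every-edge-unfolds vw λ where
        (inj₁ u) → ∉ (subst (_∈ map upward es) (upward-id v<w) (∈-map⁺ upward (covers u)))
        (inj₂ u) → ∉ (subst (_∈ map upward es) (upward-swap v<w) (∈-map⁺ upward (covers u)))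

module _ {c ℓ₁ ℓ₂} (ℝ : Reals c ℓ₁ ℓ₂) where
  open Visibility ℝ

  upper-bound : ∀ d k → URVGTreeEdges (suc d) k → k ≤ maxEdges (suc d)
  upper-bound d k (n , G , root , tree , (_ , depth) , (x , y , disjoint , visible) , refl) =
    decidable-stable (edgeCount G ℕ.≤? maxEdges (suc d)) $ do
      ◁ʰ?  ← ¬¬-∀-Fin λ v → ¬¬-∀-Fin λ w → ¬¬-excluded-middle {A = v H.◁ w}
      ⊑ʰ? ← ¬¬-∀-Fin λ v → ¬¬-∀-Fin λ w → ¬¬-excluded-middle {A = v H.⊑ w}
      ◁ᵛ? ← ¬¬-∀-Fin λ v → ¬¬-∀-Fin λ w → ¬¬-excluded-middle {A = v V.◁ w}
      ⊑ᵛ? ← ¬¬-∀-Fin λ v → ¬¬-∀-Fin λ w → ¬¬-excluded-middle {A = v V.⊑ w}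
      let split : ∀ {v w} → Adj v w → (v H.⊑ w ⊎ w H.⊑ v) ⊎ (v V.⊑ w ⊎ w V.⊑ v)
          split {v} {w} vw = decidable-stable
            ((⊑ʰ? v w ⊎-dec ⊑ʰ? w v) ⊎-dec (⊑ᵛ? v w ⊎-dec ⊑ᵛ? w v))
            ([ (λ h ¬s → H.band⇒beside h (¬s ∘ inj₁)) , (λ b ¬s → V.band⇒beside b (¬s ∘ inj₂)) ]′
               (Equivalence.to (visible v w (λ v≡w → irrefl v≡w vw)) vw))
      return (edgeCount-bound G root d tree depth
        (TwoDirections.edges-from adj? symm (λ vw v≡w → irrefl v≡w vw)
          (H.rows ◁ʰ? ⊑ʰ?) (V.rows ◁ᵛ? ⊑ᵛ?) split d root))
    where
    open Graph G
    module H = VisibilityRows ℝ G (proj₂ tree) x y disjoint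
                 (λ v w v≢w band → Equivalence.from (visible v w v≢w) (inj₁ band))
    module V = VisibilityRows ℝ G (proj₂ tree) y x
                 (λ v w v≢w p q → λ (v∈ , w∈) → disjoint v w v≢w q p (swap v∈ , swap w∈))
                 (λ v w v≢w band → Equivalence.from (visible v w v≢w) (inj₂ band))

-- The closed form

-- The recurrence of X² - 5 X + 2, whose roots are the bases of the powers in
-- the closed form; moved so that no subtraction occurs.
maxEdges-recurrence : ∀ s → (maxEdges (2 ℕ.+ s) ℕ.+ 2) ℕ.+ 2 ℕ.* (maxEdges s ℕ.+ 2) ≡
                            5 ℕ.* (maxEdges (1 ℕ.+ s) ℕ.+ 2)
maxEdges-recurrence zero    = refl
maxEdges-recurrence (suc d) = solve 2 (λ S L →
  (total (spine (spine S L) (leg S L)) (leg (spine S L) (leg S L)) :+ con 2) :+ con 2 :* (total S L :+ con 2) :=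
  con 5 :* (total (spine S L) (leg S L) :+ con 2)) refl (spineEdges d) (legEdges d)
  where
  open +-*-Solver
  row spine leg total : Polynomial 2 → Polynomial 2 → Polynomial 2
  row S L   = ((con 1 :+ S) :+ (con 1 :+ S)) :+ (con 1 :+ L)
  spine S L = ((con 1 :+ S) :+ (con 1 :+ L)) :+ row S L
  leg S L   = (con 1 :+ L) :+ row S L
  total S L = row S L :+ row S L

module ClosedForm {c ℓ₁ ℓ₂} (ℝ : Reals c ℓ₁ ℓ₂)
                  (√17 : Reals.Carrier ℝ) (0<√17 : Reals._<_ ℝ (Reals.0# ℝ) √17)
                  (√17² : Reals._≈_ ℝ (Reals._*_ ℝ √17 √17) (Reals.fromℕ ℝ 17)) where
  open RealOrder ℝ
  open Mult R.semiring using (×-homo-+; ×1-homo-*)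
  open RingProperties R.ring using (+-cancelʳ)
  open NaturalCoefficients R.commutativeSemiring using (solve; _:+_; _:*_; _:=_; con; Polynomial)
  open SetoidReasoning R.setoid

  private
    -- con k denotes an optimised k × 1#, which is not fromℕ k on the nose.
    num : ∀ {k} → ℕ → Polynomial k
    num zero    = con 0
    num (suc m) = con 1 :+ num m

    -- The solver works over commutative semirings, so the negatives `t` and `n` are treated as
    -- variables, tied to the rest by `t+√17≈0`, `n+3i≈0` and `nt≈3`.
    t i n : Carrier
    t = - √17
    i = inverse √17 0<√17
    n = - (fromℕ 3 * i)
    α β p q : Carrier
    α = ½ * (fromℕ 5 - √17)
    β = ½ * (fromℕ 5 + √17)
    p = 1# - fromℕ 3 * i
    q = 1# + fromℕ 3 * i

    t+√17≈0 : t + √17 R.≈ 0#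
    t+√17≈0 = R.-‿inverseˡ √17

    n+3i≈0 : n + fromℕ 3 * i R.≈ 0#
    n+3i≈0 = R.-‿inverseˡ _

    α+β≈5 : α + β R.≈ fromℕ 5
    α+β≈5 = begin
      ½ * (fromℕ 5 + t) + ½ * (fromℕ 5 + √17)
        ≈⟨ solve 3 (λ h t r → h :* (num 5 :+ t) :+ h :* (num 5 :+ r) :=
                              (h :+ h) :* num 5 :+ h :* (t :+ r)) R.refl ½ t √17 ⟩
      (½ + ½) * fromℕ 5 + ½ * (t + √17)  ≈⟨ R.+-cong (R.*-congʳ ½+½≈1) (R.*-congˡ t+√17≈0) ⟩
      1# * fromℕ 5 + ½ * 0#              ≈⟨ R.+-cong (R.*-identityˡ _) (R.zeroʳ ½) ⟩
      fromℕ 5 + 0#                       ≈⟨ R.+-identityʳ _ ⟩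
      fromℕ 5                            ∎

    αβ≈2 : α * β R.≈ fromℕ 2
    αβ≈2 = begin
      (½ * (fromℕ 5 + t)) * (½ * (fromℕ 5 + √17))
        -- Here 25 is split as 8 + 17, so that 17 can be traded for the square of `√17` and
        -- cancelled against `t * √17`.
        ≈⟨ solve 3 (λ h t r → (h :* (num 5 :+ t)) :* (h :* (num 5 :+ r)) :=
                              (h :* h) :* (num 8 :+ num 5 :* (t :+ r) :+ (t :* r :+ num 17)))
                 R.refl ½ t √17 ⟩
      (½ * ½) * (fromℕ 8 + fromℕ 5 * (t + √17) + (t * √17 + fromℕ 17))
        ≈⟨ R.*-congˡ (R.+-cong (R.+-congˡ (R.*-congˡ t+√17≈0)) (R.+-congˡ (R.sym √17²))) ⟩
      (½ * ½) * (fromℕ 8 + fromℕ 5 * 0# + (t * √17 + √17 * √17))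
        ≈⟨ solve 3 (λ h t r → (h :* h) :* (num 8 :+ num 5 :* num 0 :+ (t :* r :+ r :* r)) :=
                              (h :+ h) :* (h :+ h) :* num 2 :+ (h :* h) :* ((t :+ r) :* r))
                 R.refl ½ t √17 ⟩
      (½ + ½) * (½ + ½) * fromℕ 2 + (½ * ½) * ((t + √17) * √17)
        ≈⟨ R.+-cong (R.*-congʳ (R.*-cong ½+½≈1 ½+½≈1)) (R.*-congˡ (R.*-congʳ t+√17≈0)) ⟩
      1# * 1# * fromℕ 2 + (½ * ½) * (0# * √17)
        ≈⟨ solve 2 (λ h r → con 1 :* con 1 :* num 2 :+ (h :* h) :* (num 0 :* r) := num 2) R.refl ½ √17 ⟩
      fromℕ 2 ∎

    p+q≈2 : p + q R.≈ fromℕ 2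
    p+q≈2 = begin
      (1# + n) + (1# + fromℕ 3 * i)
        ≈⟨ solve 2 (λ n m → (con 1 :+ n) :+ (con 1 :+ m) := num 2 :+ (n :+ m)) R.refl n (fromℕ 3 * i) ⟩
      fromℕ 2 + (n + fromℕ 3 * i)  ≈⟨ R.+-congˡ n+3i≈0 ⟩
      fromℕ 2 + 0#                 ≈⟨ R.+-identityʳ _ ⟩
      fromℕ 2                      ∎

    nt≈3 : n * t R.≈ fromℕ 3
    nt≈3 = begin
      - (fromℕ 3 * i) * - √17  ≈⟨ R.sym (-‿distribˡ-* _ _) ⟩
      - (fromℕ 3 * i * - √17)  ≈⟨ R.-‿cong (R.sym (-‿distribʳ-* _ _)) ⟩
      - - (fromℕ 3 * i * √17)  ≈⟨ -‿involutive _ ⟩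
      fromℕ 3 * i * √17        ≈⟨ R.trans (R.*-assoc _ _ _) (R.*-congˡ (R.*-comm i √17)) ⟩
      fromℕ 3 * (√17 * i)      ≈⟨ R.*-congˡ (inverse-inverseʳ √17 0<√17) ⟩
      fromℕ 3 * 1#             ≈⟨ R.*-identityʳ _ ⟩
      fromℕ 3                  ∎

    pα+qβ≈8 : p * α + q * β R.≈ fromℕ 8
    pα+qβ≈8 = begin
      (1# + n) * (½ * (fromℕ 5 + t)) + (1# + fromℕ 3 * i) * (½ * (fromℕ 5 + √17))
        ≈⟨ solve 5 (λ h t r n i →
             (con 1 :+ n) :* (h :* (num 5 :+ t)) :+ (con 1 :+ num 3 :* i) :* (h :* (num 5 :+ r)) :=
             h :* (num 10 :+ num 5 :* (n :+ num 3 :* i) :+ (t :+ r) :+ n :* t :+ num 3 :* (r :* i)))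
             R.refl ½ t √17 n i ⟩
      ½ * (fromℕ 10 + fromℕ 5 * (n + fromℕ 3 * i) + (t + √17) + n * t + fromℕ 3 * (√17 * i))
        ≈⟨ R.*-congˡ (R.+-cong (R.+-cong (R.+-cong (R.+-congˡ (R.*-congˡ n+3i≈0)) t+√17≈0) nt≈3)
                               (R.*-congˡ (inverse-inverseʳ √17 0<√17))) ⟩
      ½ * (fromℕ 10 + fromℕ 5 * 0# + 0# + fromℕ 3 + fromℕ 3 * 1#)
        ≈⟨ solve 1 (λ h → h :* (num 10 :+ num 5 :* num 0 :+ num 0 :+ num 3 :+ num 3 :* con 1) :=
                          (h :+ h) :* num 8) R.refl ½ ⟩
      (½ + ½) * fromℕ 8  ≈⟨ R.*-congʳ ½+½≈1 ⟩
      1# * fromℕ 8       ≈⟨ R.*-identityˡ _ ⟩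
      fromℕ 8            ∎

    G : ℕ → Carrier
    G s = p * α ^ s + q * β ^ s

    G-recurrence : ∀ s → G (2 ℕ.+ s) + fromℕ 2 * G s R.≈ fromℕ 5 * G (1 ℕ.+ s)
    G-recurrence s = begin
      p * (α * (α * α ^ s)) + q * (β * (β * β ^ s)) + fromℕ 2 * (p * α ^ s + q * β ^ s)
        ≈⟨ R.+-congˡ (R.*-congʳ (R.sym αβ≈2)) ⟩
      p * (α * (α * α ^ s)) + q * (β * (β * β ^ s)) + (α * β) * (p * α ^ s + q * β ^ s)
        ≈⟨ solve 6 (λ p q α β x y →
             p :* (α :* (α :* x)) :+ q :* (β :* (β :* y)) :+ (α :* β) :* (p :* x :+ q :* y) :=
             (α :+ β) :* (p :* (α :* x) :+ q :* (β :* y))) R.refl p q α β (α ^ s) (β ^ s) ⟩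
      (α + β) * (p * (α * α ^ s) + q * (β * β ^ s))
        ≈⟨ R.*-congʳ α+β≈5 ⟩
      fromℕ 5 * (p * (α * α ^ s) + q * (β * β ^ s)) ∎

    fromℕ-recurrence : ∀ s → fromℕ (maxEdges (2 ℕ.+ s) ℕ.+ 2) + fromℕ 2 * fromℕ (maxEdges s ℕ.+ 2) R.≈
                             fromℕ 5 * fromℕ (maxEdges (1 ℕ.+ s) ℕ.+ 2)
    fromℕ-recurrence s = begin
      fromℕ a + fromℕ 2 * fromℕ b    ≈⟨ R.+-congˡ (R.sym (×1-homo-* 2 b)) ⟩
      fromℕ a + fromℕ (2 ℕ.* b)      ≈⟨ R.sym (×-homo-+ 1# a (2 ℕ.* b)) ⟩
      fromℕ (a ℕ.+ 2 ℕ.* b)          ≡⟨ cong fromℕ (maxEdges-recurrence s) ⟩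
      fromℕ (5 ℕ.* c′)               ≈⟨ ×1-homo-* 5 c′ ⟩
      fromℕ 5 * fromℕ c′             ∎
      where
      a = maxEdges (2 ℕ.+ s) ℕ.+ 2
      b = maxEdges s ℕ.+ 2
      c′ = maxEdges (1 ℕ.+ s) ℕ.+ 2

    -- Both sides obey the same second-order recurrence and start with 2 and 8.
    maxEdges≈G : ∀ s → fromℕ (maxEdges s ℕ.+ 2) R.≈ G s
    maxEdges≈G zero = R.sym (R.trans (R.+-cong (R.*-identityʳ p) (R.*-identityʳ q)) p+q≈2)
    maxEdges≈G (suc zero) =
      R.sym (R.trans (R.+-cong (R.*-congˡ (R.*-identityʳ α)) (R.*-congˡ (R.*-identityʳ β))) pα+qβ≈8)
    maxEdges≈G (suc (suc s)) = +-cancelʳ (fromℕ 2 * G s) _ _ (begin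
      fromℕ (maxEdges (2 ℕ.+ s) ℕ.+ 2) + fromℕ 2 * G s
        ≈⟨ R.+-congˡ (R.*-congˡ (R.sym (maxEdges≈G s))) ⟩
      fromℕ (maxEdges (2 ℕ.+ s) ℕ.+ 2) + fromℕ 2 * fromℕ (maxEdges s ℕ.+ 2)
        ≈⟨ fromℕ-recurrence s ⟩
      fromℕ 5 * fromℕ (maxEdges (1 ℕ.+ s) ℕ.+ 2)  ≈⟨ R.*-congˡ (maxEdges≈G (suc s)) ⟩
      fromℕ 5 * G (1 ℕ.+ s)                      ≈⟨ R.sym (G-recurrence s) ⟩
      G (2 ℕ.+ s) + fromℕ 2 * G s                ∎)

  maxEdges≈closedForm : ∀ s → fromℕ (maxEdges s) R.≈ closedForm √17 0<√17 s
  maxEdges≈closedForm s = begin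
    fromℕ (maxEdges s)                            ≈⟨ R.sym (R.+-identityˡ _) ⟩
    0# + fromℕ (maxEdges s)                       ≈⟨ R.+-congʳ (R.sym (R.-‿inverseˡ (fromℕ 2))) ⟩
    - fromℕ 2 + fromℕ 2 + fromℕ (maxEdges s)      ≈⟨ R.+-assoc _ _ _ ⟩
    - fromℕ 2 + (fromℕ 2 + fromℕ (maxEdges s))    ≈⟨ R.+-congˡ (R.+-comm _ _) ⟩
    - fromℕ 2 + (fromℕ (maxEdges s) + fromℕ 2)    ≈⟨ R.+-congˡ (R.sym (×-homo-+ 1# (maxEdges s) 2)) ⟩
    - fromℕ 2 + fromℕ (maxEdges s ℕ.+ 2)          ≈⟨ R.+-congˡ (maxEdges≈G s) ⟩
    - fromℕ 2 + G s                               ≈⟨ R.sym (R.+-assoc _ _ _) ⟩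
    closedForm √17 0<√17 s                        ∎

-- The extremal tree

module Words where
  open import Data.Nat.Base using (_+_; _<_)

  data Dir : Set where
    H V : Dir

  opp : Dir → Dir
  opp H = V
  opp V = H

  opp≢ : ∀ d → opp d ≢ d
  opp≢ H ()
  opp≢ V ()

  opp-unique : ∀ {d e} → e ≢ d → e ≡ opp d
  opp-unique {H} {H} e≢d = contradiction refl e≢d
  opp-unique {H} {V} e≢d = refl
  opp-unique {V} {H} e≢d = refl
  opp-unique {V} {V} e≢d = contradiction refl e≢d

  data Kind : Set where
    up down leg : Kind

  infix 4 _≟ᵈ_ _≟ᵏ_
  _≟ᵈ_ : DecidableEquality Dir
  H ≟ᵈ H = yes refl
  H ≟ᵈ V = no λ ()
  V ≟ᵈ H = no λ ()
  V ≟ᵈ V = yes refl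

  _≟ᵏ_ : DecidableEquality Kind
  up   ≟ᵏ up   = yes refl
  up   ≟ᵏ down = no λ ()
  up   ≟ᵏ leg  = no λ ()
  down ≟ᵏ up   = no λ ()
  down ≟ᵏ down = yes refl
  down ≟ᵏ leg  = no λ ()
  leg  ≟ᵏ up   = no λ ()
  leg  ≟ᵏ down = no λ ()
  leg  ≟ᵏ leg  = yes refl

  Letter : Set
  Letter = Dir × Kind

  infix 4 _≟ˡ_
  _≟ˡ_ : DecidableEquality Letter
  _≟ˡ_ = ≡-dec _≟ᵈ_ _≟ᵏ_

  -- A vertex of the extremal tree is the word of steps leading to it from the
  -- root, the last step first.  A row is a staircase (its spine), each of whose
  -- squares carries a leg of aligned squares.
  Word : Set
  Word = List Letter

  -- A spine keeps its sense and a leg never becomes a spine again, so subtree sizes follow the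
  -- recursions of `spineEdges` and `legEdges`.
  continuations : Kind → List Kind
  continuations up   = up ∷ leg ∷ []
  continuations down = down ∷ leg ∷ []
  continuations leg  = leg ∷ []

  turn : Dir → List Letter
  turn d = (d , up) ∷ (d , down) ∷ (d , leg) ∷ []

  next : Word → List Letter
  next []            = turn H ++ turn V
  next ((d , k) ∷ _) = map (d ,_) (continuations k) ++ turn (opp d)

  words : ℕ → Word → List Word
  words zero    w = [ w ]
  words (suc s) w = w ∷ concatMap (λ ℓ → words s (ℓ ∷ w)) (next w)

  words-root : ∀ s {w} → w ∈ words s w
  words-root zero    = here refl
  words-root (suc s) = here refl

  words-suc : ∀ s {w ℓ x} → ℓ ∈ next w → x ∈ words s (ℓ ∷ w) → x ∈ words (suc s) w
  words-suc s {w} ℓ∈ x∈ = there (∈-concatMap⁺ (λ ℓ → words s (ℓ ∷ w)) (lose ℓ∈ x∈))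

  words-suc⁻ : ∀ s {w x} → x ∈ words (suc s) w → x ≡ w ⊎ ∃[ ℓ ] ℓ ∈ next w × x ∈ words s (ℓ ∷ w)
  words-suc⁻ s     (here x≡w) = inj₁ x≡w
  words-suc⁻ s {w} (there x∈) =
    inj₂ (find (∈-concatMap⁻ (λ ℓ → words s (ℓ ∷ w)) x∈))

  words-init : ∀ s {w x} → x ∈ words s w →
               x ≡ w ⊎ ∃[ ℓ ] ∃[ u ] x ≡ ℓ ∷ u × ℓ ∈ next u × u ∈ words s w
  words-init zero (here x≡w) = inj₁ x≡w
  words-init (suc s) x∈ with words-suc⁻ s x∈
  ... | inj₁ x≡w = inj₁ x≡w
  ... | inj₂ (ℓ , ℓ∈ , x∈′) with words-init s x∈′
  ...   | inj₁ refl                      = inj₂ (ℓ , _ , refl , ℓ∈ , words-root (suc s))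
  ...   | inj₂ (ℓ′ , u , eq , ℓ′∈ , u∈) = inj₂ (ℓ′ , u , eq , ℓ′∈ , words-suc s ℓ∈ u∈)

  words-tail : ∀ s {ℓ u} → ℓ ∷ u ∈ words s [] → ℓ ∈ next u × u ∈ words s []
  words-tail s ℓu∈ with words-init s ℓu∈
  ... | inj₂ (_ , _ , refl , ℓ∈ , u∈) = ℓ∈ , u∈

  words-suffix : ∀ s p {u} → p ++ u ∈ words s [] → u ∈ words s []
  words-suffix s []      u∈ = u∈
  words-suffix s (_ ∷ p) u∈ = words-suffix s p (proj₂ (words-tail s u∈))

  words-prefix : ∀ s {w x} → x ∈ words s w → ∃[ p ] x ≡ p ++ w × length p ≤ s
  words-prefix zero (here refl) = [] , refl , z≤n
  words-prefix (suc s) x∈ with words-suc⁻ s x∈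
  ... | inj₁ refl = [] , refl , z≤n
  ... | inj₂ (ℓ , _ , x∈′) with words-prefix s x∈′
  ...   | p , refl , p≤s = p ++ [ ℓ ] , sym (List.++-assoc p _ _) ,
    subst (_≤ suc s) (sym (trans (List.length-++ p) (ℕ.+-comm (length p) 1))) (s≤s p≤s)

  words-length : ∀ s {x} → x ∈ words s [] → length x ≤ s
  words-length s x∈ with words-prefix s x∈
  ... | p , refl , p≤s = subst (_≤ s) (cong length (sym (List.++-identityʳ p))) p≤s

  -- At `j = 0` this is a word of full length, showing that depth `s` is reached; `j` counts the
  -- steps already taken.
  replicate-leg : ∀ s j → replicate s (H , leg) ++ replicate j (H , leg) ∈ words s (replicate j (H , leg))
  replicate-leg zero    j = here refl
  replicate-leg (suc s) j = words-suc s (leg-next j)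
    (subst (_∈ words s (replicate (suc j) (H , leg))) (shift s j) (replicate-leg s (suc j)))
    where
    leg-next : ∀ j → (H , leg) ∈ next (replicate j (H , leg))
    leg-next zero    = there (there (here refl))
    leg-next (suc j) = here refl
    shift : ∀ s j → replicate s (H , leg) ++ replicate (suc j) (H , leg) ≡
                    replicate (suc s) (H , leg) ++ replicate j (H , leg)
    shift zero    j = refl
    shift (suc s) j = cong ((H , leg) ∷_) (shift s j)

  ++-same-suffix : ∀ {p q u v : Word} → length u ≡ length v → p ++ u ≡ q ++ v → u ≡ v
  ++-same-suffix {[]}    {[]}    _   eq = eq
  ++-same-suffix {[]}    {_ ∷ q} {u} {v} len eq = contradiction
    (subst₂ _<_ refl (trans (sym (cong length eq)) len) (s≤s (subst (length v ≤_) (sym (List.length-++ q)) (ℕ.m≤n+m _ _))))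
    (ℕ.<-irrefl refl)
  ++-same-suffix {_ ∷ p} {[]}    {u} {v} len eq = contradiction
    (subst₂ _<_ refl (trans (cong length eq) (sym len)) (s≤s (subst (length u ≤_) (sym (List.length-++ p)) (ℕ.m≤n+m _ _))))
    (ℕ.<-irrefl refl)
  ++-same-suffix {_ ∷ p} {_ ∷ q} len eq = ++-same-suffix {p} {q} len (List.∷-injectiveʳ eq)

  next-unique : ∀ w → Unique (next w)
  next-unique []               = from-yes (DecUnique.unique? _≟ˡ_ (next []))
  next-unique ((H , up) ∷ _)   = from-yes (DecUnique.unique? _≟ˡ_ (next [ H , up ]))
  next-unique ((H , down) ∷ _) = from-yes (DecUnique.unique? _≟ˡ_ (next [ H , down ]))
  next-unique ((H , leg) ∷ _)  = from-yes (DecUnique.unique? _≟ˡ_ (next [ H , leg ]))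
  next-unique ((V , up) ∷ _)   = from-yes (DecUnique.unique? _≟ˡ_ (next [ V , up ]))
  next-unique ((V , down) ∷ _) = from-yes (DecUnique.unique? _≟ˡ_ (next [ V , down ]))
  next-unique ((V , leg) ∷ _)  = from-yes (DecUnique.unique? _≟ˡ_ (next [ V , leg ]))

  words-unique : ∀ s w → Unique (words s w)
  words-unique zero    w = [] ∷ []
  words-unique (suc s) w =
    All.tabulate longer ∷
    Unique.concat⁺ (All.map⁺ (All.universal (λ ℓ → words-unique s (ℓ ∷ w)) (next w)))
                   (AllPairs.map⁺ (AllPairs.map disjoint (next-unique w)))
    where
    disjoint : ∀ {ℓ ℓ′} → ℓ ≢ ℓ′ → Disjoint (words s (ℓ ∷ w)) (words s (ℓ′ ∷ w))
    disjoint ℓ≢ℓ′ (x∈ , x∈′) with words-prefix s x∈ | words-prefix s x∈′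
    ... | p , refl , _ | q , eq , _ = ℓ≢ℓ′ (List.∷-injectiveˡ (++-same-suffix {p} {q} refl eq))
    longer : ∀ {x} → x ∈ concatMap (λ ℓ → words s (ℓ ∷ w)) (next w) → w ≢ x
    longer x∈ refl with find (∈-concatMap⁻ (λ ℓ → words s (ℓ ∷ w)) {xs = next w} x∈)
    ... | ℓ , _ , x∈′ with words-prefix s x∈′
    ...   | p , eq , _ = contradiction (trans (cong length eq) (trans (List.length-++ p) (ℕ.+-suc (length p) (length w))))
                                         (ℕ.<⇒≢ (s≤s (ℕ.m≤n+m (length w) (length p))))

  length-concatMap : ∀ {A B : Set} (f : A → List B) xs →
                     length (concatMap f xs) ≡ sum (map (length ∘ f) xs)
  length-concatMap f []       = refl
  length-concatMap f (x ∷ xs) = trans (List.length-++ (f x)) (cong (λ m → length (f x) + m) (length-concatMap f xs))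

  size : ℕ → Kind → ℕ
  size s up   = suc (spineEdges s)
  size s down = suc (spineEdges s)
  size s leg  = suc (legEdges s)

  length-words-suc : ∀ s → (∀ d k u → length (words s ((d , k) ∷ u)) ≡ size s k) → ∀ w →
                     length (words (suc s) w) ≡ suc (sum (map (size s ∘ proj₂) (next w)))
  length-words-suc s ih w = cong suc (trans (length-concatMap _ (next w))
    (cong sum (List.map-cong (λ (d , k) → ih d k w) (next w))))

  length-words : ∀ s d k u → length (words s ((d , k) ∷ u)) ≡ size s k
  length-words zero    d up   u = refl
  length-words zero    d down u = refl
  length-words zero    d leg  u = refl
  length-words (suc s) d k    u =
    trans (length-words-suc s (length-words s) ((d , k) ∷ u)) (total k)
    where
    spine : ∀ a b → suc a + (suc b + (suc a + (suc a + (suc b + 0)))) ≡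
                    (suc a + suc b) + ((suc a + suc a) + suc b)
    spine = solve-∀
    legs : ∀ a b → suc b + (suc a + (suc a + (suc b + 0))) ≡ suc b + ((suc a + suc a) + suc b)
    legs = solve-∀
    total : ∀ k → suc (sum (map (size s ∘ proj₂) (next ((d , k) ∷ u)))) ≡ size (suc s) k
    total up   = cong suc (spine (spineEdges s) (legEdges s))
    total down = cong suc (spine (spineEdges s) (legEdges s))
    total leg  = cong suc (legs (spineEdges s) (legEdges s))

  length-all-words : ∀ s → length (words s []) ≡ suc (maxEdges s)
  length-all-words zero    = refl
  length-all-words (suc s) = trans (length-words-suc s (length-words s) [])
    (cong suc (total (spineEdges s) (legEdges s)))
    where
    total : ∀ a b → suc a + (suc a + (suc b + (suc a + (suc a + (suc b + 0))))) ≡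
                    ((suc a + suc a) + suc b) + ((suc a + suc a) + suc b)
    total = solve-∀

open Words

open AbelianGroupProperties ℤ.+-0-abelianGroup using (∙-cancelʳ)

-- Coordinates of the extremal drawing

module Layout where
  open import Data.Nat.Base using (_+_; _*_; _%_; _<_)

  digit : Letter → ℕ
  digit (H , up)   = 0
  digit (H , down) = 1
  digit (H , leg)  = 2
  digit (V , up)   = 3
  digit (V , down) = 4
  digit (V , leg)  = 5

  letter : ℕ → Letter
  letter 0 = H , up
  letter 1 = H , down
  letter 2 = H , leg
  letter 3 = V , up
  letter 4 = V , down
  letter _ = V , leg

  letter-digit : ∀ ℓ → letter (digit ℓ) ≡ ℓ
  letter-digit (H , up)   = refl
  letter-digit (H , down) = refl
  letter-digit (H , leg)  = refl
  letter-digit (V , up)   = refl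
  letter-digit (V , down) = refl
  letter-digit (V , leg)  = refl

  digit%6 : ∀ ℓ → digit ℓ % 6 ≡ digit ℓ
  digit%6 (H , up)   = refl
  digit%6 (H , down) = refl
  digit%6 (H , leg)  = refl
  digit%6 (V , up)   = refl
  digit%6 (V , down) = refl
  digit%6 (V , leg)  = refl

  -- Bijective base 6 numeration, with the last step as lowest digit. A vertex gets a larger number
  -- than each of its ancestors.
  code : Word → ℕ
  code []      = 0
  code (ℓ ∷ w) = suc (digit ℓ + code w * 6)

  code-injective : ∀ v w → code v ≡ code w → v ≡ w
  code-injective []      []       _  = refl
  code-injective (ℓ ∷ v) (ℓ′ ∷ w) eq with same-digit
    where
    same-digit : digit ℓ ≡ digit ℓ′
    same-digit = trans (sym (trans (ℕ.[m+kn]%n≡m%n (digit ℓ) (code v) 6) (digit%6 ℓ)))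
      (trans (cong (_% 6) (ℕ.suc-injective eq)) (trans (ℕ.[m+kn]%n≡m%n (digit ℓ′) (code w) 6) (digit%6 ℓ′)))
  ... | dd = cong₂ _∷_ (trans (sym (letter-digit ℓ)) (trans (cong letter dd) (letter-digit ℓ′)))
    (code-injective v w (ℕ.*-cancelʳ-≡ (code v) (code w) 6 (ℕ.+-cancelˡ-≡ (digit ℓ) _ _
      (trans (ℕ.suc-injective eq) (cong (_+ code w * 6) (sym dd))))))

  code-∷ : ∀ ℓ w → code w < code (ℓ ∷ w)
  code-∷ ℓ w = s≤s (ℕ.≤-trans (ℕ.m≤m*n (code w) 6) (ℕ.m≤n+m _ (digit ℓ)))

  odd : ℕ → Bool
  odd zero    = false
  odd (suc n) = not (odd n)

  odd-suc : ∀ z → odd ∣ ℤ.suc z ∣ ≡ not (odd ∣ z ∣)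
  odd-suc (+ n)          = refl
  odd-suc -[1+ zero ]    = refl
  odd-suc -[1+ suc n ]   = sym (not-involutive (odd (suc n)))

  flip : Kind → Bool → Bool
  flip up   b = not b
  flip down b = not b
  flip leg  b = b

  parity : Dir → Word → Bool
  parity d [] = false
  parity d ((e , k) ∷ w) with e ≟ᵈ d
  ... | yes _ = flip k (parity d w)
  ... | no  _ = false

  shift : Kind → ℤ → ℤ
  shift up   z = ℤ.suc z
  shift down z = ℤ.pred z
  shift leg  z = z

  side : Bool → ℕ → ℤ
  side false m = ℤ.- (+ m)
  side true  m = + m

  ∣side∣ : ∀ b m → ∣ side b m ∣ ≡ m
  ∣side∣ false m = ℤ.∣-i∣≡∣i∣ (+ m)
  ∣side∣ true  m = refl

  infix 4 _⊲_
  -- In half units a square has side 2.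
  _⊲_ : ℤ → ℤ → Set
  x ⊲ y = ℤ.suc (ℤ.suc x) ℤ.≤ y

  Beyond : Bool → ℤ → ℤ → Set
  Beyond false x y = y ⊲ x
  Beyond true  x y = x ⊲ y

  i≤∣i∣ : ∀ i → i ℤ.≤ + ∣ i ∣
  i≤∣i∣ (+ n)    = ℤ.≤-refl
  i≤∣i∣ -[1+ n ] = -≤+

  -∣i∣≤i : ∀ i → ℤ.- (+ ∣ i ∣) ℤ.≤ i
  -∣i∣≤i (+ n)    = ℤ.neg-≤-pos
  -∣i∣≤i -[1+ n ] = ℤ.≤-refl

  far-out : ∀ b x {m} → 2 + ∣ x ∣ ≤ m → Beyond b x (side b m)
  far-out true  x 2+x≤m = ℤ.≤-trans (ℤ.+-monoʳ-≤ (+ 1) (ℤ.+-monoʳ-≤ (+ 1) (i≤∣i∣ x))) (+≤+ 2+x≤m)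
  far-out false x 2+x≤m = ℤ.≤-trans
    (ℤ.+-monoʳ-≤ (+ 1) (ℤ.+-monoʳ-≤ (+ 1) (ℤ.neg-mono-≤ (+≤+ 2+x≤m))))
    (subst (ℤ._≤ x) (back ∣ x ∣) (-∣i∣≤i x))
    where
    back : ∀ n → ℤ.- (+ n) ≡ ℤ.suc (ℤ.suc (ℤ.- (+ (2 + n))))
    back zero    = refl
    back (suc n) = refl

  ∣shift∣ : ∀ k z → ∣ shift k z ∣ ≤ suc ∣ z ∣
  ∣shift∣ up   z = ℤ.∣i+j∣≤∣i∣+∣j∣ (+ 1) z
  ∣shift∣ down z = ℤ.∣i+j∣≤∣i∣+∣j∣ -[1+ 0 ] z
  ∣shift∣ leg  z = ℕ.n≤1+n _

  Near : ℤ → ℤ → Set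
  Near a b = a ≡ b ⊎ b ≡ ℤ.suc a ⊎ a ≡ ℤ.suc b

  suc-cancel : ∀ {a b} c → a ℤ.+ c ≡ ℤ.suc (b ℤ.+ c) → a ≡ ℤ.suc b
  suc-cancel {a} {b} c eq = ∙-cancelʳ c a (ℤ.suc b) (trans eq (sym (ℤ.+-assoc (+ 1) b c)))

  near⇒close : ∀ {a b} → Near a b → ∣ a ℤ.- b ∣ ≤ 1
  near⇒close {a} {b} (inj₁ refl) = subst (λ x → ∣ x ∣ ≤ 1) (sym (ℤ.+-inverseʳ a)) z≤n
  near⇒close {a} {b} (inj₂ (inj₁ refl)) =
    subst (_≤ 1) (ℤ.∣i-j∣≡∣j-i∣ b a) (near⇒close {b} {a} (inj₂ (inj₂ refl)))
  near⇒close {a} {b} (inj₂ (inj₂ refl)) = subst (λ x → ∣ x ∣ ≤ 1) (sym diff) ℕ.≤-refl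
    where
    diff : ℤ.suc b ℤ.- b ≡ + 1
    diff = trans (ℤ.+-assoc (+ 1) b (ℤ.- b)) (cong ℤ.suc (ℤ.+-inverseʳ b))

  spine : Dir → Word → ℤ → Word
  spine d r (+ n)    = replicate n (d , up) ++ r
  spine d r -[1+ n ] = replicate (suc n) (d , down) ++ r

  build : Dir → Word → ℤ → ℕ → Word
  build d r z j = replicate j (d , leg) ++ spine d r z

  data RowRoot (d : Dir) : Word → Set where
    root   : RowRoot d []
    turned : ∀ {k u} → RowRoot d ((opp d , k) ∷ u)

  -- Each vertex has a slot in either direction. In at least one of the two it is itself the base,
  -- with rung 0 and no legs.
  record Slot (d : Dir) (w : Word) : Set where
    constructor slot
    field
      {base} : Word
      isRoot : RowRoot d base
      rung   : ℤ
      legs   : ℕ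
      word≡  : w ≡ build d base rung legs

  same-direction : ∀ d k {k′} → (d , k′) ∈ map (d ,_) (continuations k) ++ turn (opp d) →
                   k′ ∈ continuations k
  same-direction d k k′∈ with ∈-++⁻ (map (d ,_) (continuations k)) k′∈
  ... | inj₁ c with ∈-map⁻ (d ,_) c
  ...   | _ , k″∈ , refl = k″∈
  same-direction H _ _ | inj₂ (there (there (there ())))
  same-direction V _ _ | inj₂ (there (there (there ())))

  slotOf : ∀ s d w → w ∈ words s [] → Slot d w
  slotOf s d [] _ = slot root (+ 0) 0 refl
  slotOf s d ((e , k) ∷ u) w∈ with e ≟ᵈ d | words-tail s w∈
  ... | no e≢d | _ with opp-unique e≢d
  ...   | refl = slot turned (+ 0) 0 refl
  slotOf s d ((d , k) ∷ u) w∈ | yes refl | k∈ , u∈ with slotOf s d u u∈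
  slotOf s d ((d , leg) ∷ u)  _ | yes refl | k∈ , _ | slot r z j refl = slot r z (suc j) refl
  slotOf s d ((d , up) ∷ u)   _ | yes refl | k∈ , _ | slot r z (suc j) refl with same-direction d leg k∈
  ... | here ()
  ... | there ()
  slotOf s d ((d , down) ∷ u) _ | yes refl | k∈ , _ | slot r z (suc j) refl with same-direction d leg k∈
  ... | here ()
  ... | there ()
  slotOf s d ((d , up) ∷ u)   _ | yes refl | k∈ , _ | slot r (+ n) 0 refl = slot r (+ suc n) 0 refl
  slotOf s d ((d , up) ∷ u)   _ | yes refl | k∈ , _ | slot r -[1+ n ] 0 refl with same-direction d down k∈
  ... | there (here ())
  ... | there (there ())
  slotOf s d ((d , down) ∷ u) _ | yes refl | k∈ , _ | slot r (+ zero) 0 refl = slot r -[1+ 0 ] 0 refl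
  slotOf s d ((d , down) ∷ u) _ | yes refl | k∈ , _ | slot r -[1+ n ] 0 refl = slot r -[1+ suc n ] 0 refl
  slotOf s d ((d , down) ∷ u) _ | yes refl | k∈ , _ | slot r (+ suc n) 0 refl with same-direction d up k∈
  ... | there (here ())
  ... | there (there ())

  parity-along : ∀ d k u → parity d ((d , k) ∷ u) ≡ flip k (parity d u)
  parity-along H k u = refl
  parity-along V k u = refl

  parity-root : ∀ {d r} → RowRoot d r → parity d r ≡ false
  parity-root root = refl
  parity-root {H} turned = refl
  parity-root {V} turned = refl

  parity-build : ∀ {d r} → RowRoot d r → ∀ z j → parity d (build d r z j) ≡ odd ∣ z ∣
  parity-build {d} {r} rr z (suc j) = trans (parity-along d leg _) (parity-build rr z j)
  parity-build {d} {r} rr (+ n) zero = ups n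
    where
    ups : ∀ n → parity d (replicate n (d , up) ++ r) ≡ odd n
    ups zero    = parity-root rr
    ups (suc n) = trans (parity-along d up _) (cong not (ups n))
  parity-build {d} {r} rr -[1+ n ] zero = downs (suc n)
    where
    downs : ∀ n → parity d (replicate n (d , down) ++ r) ≡ odd n
    downs zero    = parity-root rr
    downs (suc n) = trans (parity-along d down _) (cong not (downs n))

  code-spine : ∀ d r z → code r ≤ code (spine d r z)
  code-spine d r (+ n) = go n
    where
    go : ∀ n → code r ≤ code (replicate n (d , up) ++ r)
    go zero    = ℕ.≤-refl
    go (suc n) = ℕ.≤-trans (go n) (ℕ.<⇒≤ (code-∷ (d , up) (replicate n (d , up) ++ r)))
  code-spine d r -[1+ n ] = go (suc n)
    where
    go : ∀ n → code r ≤ code (replicate n (d , down) ++ r)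
    go zero    = ℕ.≤-refl
    go (suc n) = ℕ.≤-trans (go n) (ℕ.<⇒≤ (code-∷ (d , down) (replicate n (d , down) ++ r)))

  code-legs : ∀ d r z {i j} → i ≤ j → code (build d r z i) ≤ code (build d r z j)
  code-legs d r z {zero}  {zero}  z≤n = ℕ.≤-refl
  code-legs d r z {zero}  {suc j} z≤n =
    ℕ.≤-trans (code-legs d r z {zero} {j} z≤n) (ℕ.<⇒≤ (code-∷ (d , leg) (build d r z j)))
  code-legs d r z {suc i} {suc j} (s≤s i≤j) =
    s≤s (ℕ.+-monoʳ-≤ (digit (d , leg)) (ℕ.*-monoˡ-≤ 6 (code-legs d r z i≤j)))

  code-legs-< : ∀ d r z {i j} → i < j → code (build d r z i) < code (build d r z j)
  code-legs-< d r z {i} {suc j} (s≤s i≤j) =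
    ℕ.≤-<-trans (code-legs d r z i≤j) (code-∷ (d , leg) (build d r z j))

  length-build : ∀ d r z j → ∣ z ∣ ≤ length (build d r z j)
  length-build d r z (suc j) = ℕ.m≤n⇒m≤1+n (length-build d r z j)
  length-build d r (+ n) zero = subst (n ≤_) (sym (List.length-++ (replicate n (d , up))))
    (ℕ.≤-trans (ℕ.≤-reflexive (sym (List.length-replicate n))) (ℕ.m≤m+n _ (length r)))
  length-build d r -[1+ n ] zero = subst (suc n ≤_) (sym (List.length-++ (replicate (suc n) (d , down))))
    (ℕ.≤-trans (ℕ.≤-reflexive (sym (List.length-replicate (suc n)))) (ℕ.m≤m+n _ (length r)))

  -- Coordinates in half units: pos H is the y-coordinate and pos V the
  -- x-coordinate.  A horizontal step changes y by at most one half unit and puts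
  -- the new square farther out in x than all its ancestors, on the side given by
  -- the parity of its rung.  Rows have fewer than M rungs, so distinct rows are
  -- disjoint, and squares two rungs apart do not see each other.
  module Position (s : ℕ) where

    M : ℕ
    M = 2 + (s + s)

    pos : Dir → Word → ℤ
    pos d [] = 0ℤ
    pos d w@((e , k) ∷ u) with e ≟ᵈ d
    ... | yes _ = shift k (pos d u)
    ... | no  _ = side (parity e w) (M * code w)

    pos-along : ∀ d k u → pos d ((d , k) ∷ u) ≡ shift k (pos d u)
    pos-along H k u = refl
    pos-along V k u = refl

    pos-across : ∀ d k u → let w = (d , k) ∷ u in pos (opp d) w ≡ side (parity d w) (M * code w)
    pos-across H k u = refl
    pos-across V k u = refl

    M*-gap : ∀ {a b} → a < b → 2 + M * a ≤ M * b
    M*-gap {a} {b} a<b = ℕ.≤-trans (ℕ.+-monoˡ-≤ (M * a) (ℕ.m≤m+n 2 (s + s)))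
      (ℕ.≤-trans (ℕ.≤-reflexive (sym (ℕ.*-suc M a))) (ℕ.*-monoʳ-≤ M a<b))

    -- With `M*-gap`, this places a new square, put at distance `M * code`, beyond all its
    -- ancestors.
    ∣pos∣≤ : ∀ d w → ∣ pos d w ∣ ≤ M * code w
    ∣pos∣≤ d [] = z≤n
    ∣pos∣≤ d ((e , k) ∷ u) with e ≟ᵈ d
    ... | yes refl = ℕ.≤-trans (∣shift∣ k (pos d u)) (ℕ.≤-trans (s≤s (∣pos∣≤ d u))
      (ℕ.<⇒≤ (M*-gap (code-∷ (d , k) u))))
    ... | no e≢d = ℕ.≤-reflexive (∣side∣ (parity e ((e , k) ∷ u)) _)

    ∣pos-root∣ : ∀ {d r} → RowRoot d r → ∣ pos d r ∣ ≡ M * code r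
    ∣pos-root∣ root = sym (ℕ.*-zeroʳ M)
    ∣pos-root∣ {H} (turned {k} {u}) = ∣side∣ (parity V ((V , k) ∷ u)) _
    ∣pos-root∣ {V} (turned {k} {u}) = ∣side∣ (parity H ((H , k) ∷ u)) _

    pos-build : ∀ d r z j → pos d (build d r z j) ≡ z ℤ.+ pos d r
    pos-build d r z (suc j) = trans (pos-along d leg _) (pos-build d r z j)
    pos-build d r (+ n) zero = ups n
      where
      ups : ∀ n → pos d (replicate n (d , up) ++ r) ≡ + n ℤ.+ pos d r
      ups zero    = sym (ℤ.+-identityˡ _)
      ups (suc n) = trans (pos-along d up _) (trans (cong ℤ.suc (ups n)) (sym (ℤ.+-assoc (+ 1) (+ n) (pos d r))))
    pos-build d r -[1+ n ] zero = downs (suc n)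
      where
      downs : ∀ n → pos d (replicate n (d , down) ++ r) ≡ ℤ.- (+ n) ℤ.+ pos d r
      downs zero    = sym (ℤ.+-identityˡ _)
      downs (suc n) = trans (pos-along d down _) (trans (cong ℤ.pred (downs n))
        (trans (sym (ℤ.+-assoc -[1+ 0 ] (ℤ.- (+ n)) _)) (cong (ℤ._+ pos d r) (sym (ℤ.neg-suc n)))))

    across-legs : ∀ {d r} → RowRoot d r → ∀ z j →
                  pos (opp d) (build d r z (suc j)) ≡ side (odd ∣ z ∣) (M * code (build d r z (suc j)))
    across-legs {d} {r} rr z j = trans (pos-across d leg (build d r z j))
      (cong (λ b → side b (M * code (build d r z (suc j)))) (parity-build rr z (suc j)))

    across-spine : ∀ {d r} → RowRoot d r → ∀ z → z ≢ 0ℤ →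
                   pos (opp d) (spine d r z) ≡ side (odd ∣ z ∣) (M * code (spine d r z))
    across-spine rr (+ zero) z≢0 = contradiction refl z≢0
    across-spine {d} {r} rr z@(+ suc n) _ = trans (pos-across d up (replicate n (d , up) ++ r))
      (cong (λ b → side b (M * code (spine d r z))) (parity-build rr z 0))
    across-spine {d} {r} rr z@(-[1+ n ]) _ = trans (pos-across d down (replicate n (d , down) ++ r))
      (cong (λ b → side b (M * code (spine d r z))) (parity-build rr z 0))

    legs-beyond : ∀ {d r} → RowRoot d r → ∀ z {i j} → i < j →
                  Beyond (odd ∣ z ∣) (pos (opp d) (build d r z i)) (pos (opp d) (build d r z j))
    legs-beyond {d} {r} rr z {i} {suc j} i<j rewrite across-legs rr z j =
      far-out (odd ∣ z ∣) (pos (opp d) (build d r z i))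
        (ℕ.≤-trans (s≤s (s≤s (∣pos∣≤ (opp d) (build d r z i)))) (M*-gap (code-legs-< d r z i<j)))

    -- Only the base has a coordinate inherited from its other row, of either sign but bounded by
    -- `M * code r`; every other even square has a coordinate at most 0.
    even-left : ∀ {d r} → RowRoot d r → ∀ z j → odd ∣ z ∣ ≡ false →
                pos (opp d) (build d r z j) ℤ.≤ + (M * code r)
    even-left {d} {r} rr z (suc j) even rewrite across-legs rr z j | even = ℤ.neg-≤-pos
    even-left {d} {r} rr z zero even with z ℤ.≟ 0ℤ
    ... | yes refl = ℤ.≤-trans (i≤∣i∣ _) (+≤+ (∣pos∣≤ (opp d) r))
    ... | no z≢0 rewrite across-spine rr z z≢0 | even = ℤ.neg-≤-pos

    odd-right : ∀ {d r} → RowRoot d r → ∀ z j → odd ∣ z ∣ ≡ true →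
                + (2 + M * code r) ℤ.≤ pos (opp d) (build d r z j)
    odd-right {d} {r} rr z (suc j) o rewrite across-legs rr z j | o =
      +≤+ (M*-gap (ℕ.≤-<-trans (code-spine d r z) (code-legs-< d r z {0} {suc j} (s≤s z≤n))))
    odd-right {d} {r} rr z@(+ suc n) zero o rewrite across-spine {d} rr z (λ ()) | o =
      +≤+ (M*-gap (ℕ.≤-<-trans (code-spine d r (+ n)) (code-∷ (d , up) (replicate n (d , up) ++ r))))
    odd-right {d} {r} rr z@(-[1+ n ]) zero o rewrite across-spine {d} rr z (λ ()) | o =
      +≤+ (M*-gap (strict n))
      where
      strict : ∀ n → code r < code (replicate (suc n) (d , down) ++ r)
      strict zero    = code-∷ (d , down) r
      strict (suc n) = ℕ.<-trans (strict n) (code-∷ (d , down) (replicate (suc n) (d , down) ++ r))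

    even⊲odd : ∀ {d r} → RowRoot d r → ∀ z i z′ j → odd ∣ z ∣ ≡ false → odd ∣ z′ ∣ ≡ true →
               pos (opp d) (build d r z i) ⊲ pos (opp d) (build d r z′ j)
    even⊲odd rr z i z′ j even o = ℤ.≤-trans
      (ℤ.+-monoʳ-≤ (+ 1) (ℤ.+-monoʳ-≤ (+ 1) (even-left rr z i even))) (odd-right rr z′ j o)

    opposite : ∀ {d r} → RowRoot d r → ∀ z i z′ j → odd ∣ z′ ∣ ≡ not (odd ∣ z ∣) →
               Beyond (not (odd ∣ z ∣)) (pos (opp d) (build d r z i)) (pos (opp d) (build d r z′ j))
    opposite rr z i z′ j eq with odd ∣ z ∣ in oz
    ... | false = even⊲odd rr z i z′ j oz eq
    ... | true  = even⊲odd rr z′ j z i eq oz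

    -- Each square is at most `s` half units from the level of its base, so the levels of the two
    -- bases differ by at most `1 + 2 s`. This is less than `M`, while their absolute values are `M`
    -- times the codes.
    same-row : ∀ {d r r′} → RowRoot d r → RowRoot d r′ → ∀ z z′ →
               ∣ z ∣ ≤ s → ∣ z′ ∣ ≤ s → ∀ i j → Near (pos d (build d r z i)) (pos d (build d r′ z′ j)) → r ≡ r′
    same-row {d} {r} {r′} rr rr′ z z′ z≤s z′≤s i j near =
      code-injective r r′ (ℕ.≤-antisym (below rr rr′ close) (below rr′ rr close′))
      where
      p p′ : ℤ
      p = pos d r
      p′ = pos d r′
      distance : ∀ z z′ p p′ → p ℤ.- p′ ≡ ((z ℤ.+ p) ℤ.- (z′ ℤ.+ p′)) ℤ.- (z ℤ.- z′)
      distance = ℤSolver.solve-∀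
      close : ∣ p ℤ.- p′ ∣ ≤ 1 + (s + s)
      close = subst (λ x → ∣ x ∣ ≤ 1 + (s + s)) (sym (distance z z′ p p′))
        (ℕ.≤-trans (ℤ.∣i-j∣≤∣i∣+∣j∣ ((z ℤ.+ p) ℤ.- (z′ ℤ.+ p′)) (z ℤ.- z′)) (ℕ.+-mono-≤
          (near⇒close {z ℤ.+ p} {z′ ℤ.+ p′} (subst₂ Near (pos-build d r z i) (pos-build d r′ z′ j) near))
          (ℕ.≤-trans (ℤ.∣i-j∣≤∣i∣+∣j∣ z z′) (ℕ.+-mono-≤ z≤s z′≤s))))
      close′ : ∣ p′ ℤ.- p ∣ ≤ 1 + (s + s)
      close′ = subst (_≤ 1 + (s + s)) (ℤ.∣i-j∣≡∣j-i∣ p p′) close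
      below : ∀ {r r′} → RowRoot d r → RowRoot d r′ → ∣ pos d r ℤ.- pos d r′ ∣ ≤ 1 + (s + s) → code r ≤ code r′
      below {r} {r′} rr rr′ c = s≤s⁻¹ (ℕ.*-cancelˡ-< M (code r) (suc (code r′)) (ℕ.≤-<-trans bound
        (ℕ.≤-reflexive (sym (ℕ.*-suc M (code r′))))))
        where
        split : ∀ p p′ → p ≡ (p ℤ.- p′) ℤ.+ p′
        split = ℤSolver.solve-∀
        bound : M * code r ≤ (1 + (s + s)) + M * code r′
        bound = subst₂ _≤_ (∣pos-root∣ rr) (cong (λ x → (1 + (s + s)) + x) (∣pos-root∣ rr′))
          (subst (λ x → ∣ x ∣ ≤ 1 + (s + s) + ∣ pos d r′ ∣) (sym (split (pos d r) (pos d r′)))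
            (ℕ.≤-trans (ℤ.∣i+j∣≤∣i∣+∣j∣ (pos d r ℤ.- pos d r′) (pos d r′)) (ℕ.+-monoˡ-≤ ∣ pos d r′ ∣ c)))

open Layout

-- Bands between squares with half-integral coordinates

pred-cancel : ∀ {a b} → ℤ.suc a ℤ.≤ ℤ.suc b → a ℤ.≤ b
pred-cancel {a} {b} le = subst (ℤ._≤ b) (ℤ.pred-suc a) (subst (ℤ.pred (ℤ.suc a) ℤ.≤_) (ℤ.pred-suc b) (ℤ.pred-mono le))

<suc⇒≤ : ∀ {a b} → a ℤ.< ℤ.suc b → a ℤ.≤ b
<suc⇒≤ = pred-cancel ∘ ℤ.i<j⇒suc[i]≤j

within : ∀ {a b} → a ℤ.≤ b → b ℤ.≤ ℤ.suc a → b ≡ a ⊎ b ≡ ℤ.suc a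
within {a} {b} a≤b b≤1+a with a ℤ.≟ b
... | yes refl = inj₁ refl
... | no a≢b   = inj₂ (ℤ.≤-antisym b≤1+a (ℤ.i<j⇒suc[i]≤j (ℤ.≤∧≢⇒< a≤b a≢b)))

close⇒near : ∀ {a b} → a ℤ.< ℤ.suc (ℤ.suc b) → b ℤ.< ℤ.suc (ℤ.suc a) → Near a b
close⇒near {a} {b} a<b+2 b<a+2 with ℤ.≤-total a b
... | inj₁ a≤b = [ inj₁ ∘ sym , inj₂ ∘ inj₁ ]′ (within a≤b (<suc⇒≤ b<a+2))
... | inj₂ b≤a = [ inj₁ , inj₂ ∘ inj₂ ]′ (within b≤a (<suc⇒≤ a<b+2))

module HalfIntegers {c ℓ₁ ℓ₂} (ℝ : Reals c ℓ₁ ℓ₂) where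
  open RealOrder ℝ
  open RingProperties R.ring using (-‿+-comm; -0#≈0#)

  half : ℤ → Carrier
  half (+ n)    = n · ½
  half -[1+ n ] = - (suc n · ½)

  half-suc : ∀ z → half (ℤ.suc z) R.≈ half z + ½
  half-suc (+ n)        = R.+-comm ½ (n · ½)
  half-suc -[1+ zero ]  = R.sym (R.trans (R.+-congʳ (R.-‿cong (R.+-identityʳ ½))) (R.-‿inverseˡ ½))
  half-suc -[1+ suc n ] = R.sym (R.trans (R.+-congʳ (R.trans (R.-‿cong (R.+-comm ½ _)) (R.sym (-‿+-comm (suc n · ½) ½))))
    (R.trans (R.+-assoc _ _ _) (R.trans (R.+-congˡ (R.-‿inverseˡ ½)) (R.+-identityʳ _))))

  half-+1 : ∀ z → half (ℤ.suc (ℤ.suc z)) R.≈ half z + 1#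
  half-+1 z = R.trans (half-suc (ℤ.suc z)) (R.trans (R.+-congʳ (half-suc z))
    (R.trans (R.+-assoc _ _ _) (R.+-congˡ ½+½≈1)))

  neg-mono-< : ∀ {x y} → x < y → - y < - x
  neg-mono-< {x} {y} x<y = +-cancelʳ-< (x + y) (<-respˡ-≈ (R.sym -y+[x+y]≈x) (<-respʳ-≈ (R.sym (drop x y)) x<y))
    where
    drop : ∀ x y → - x + (x + y) R.≈ y
    drop x y = R.trans (R.sym (R.+-assoc _ _ _)) (R.trans (R.+-congʳ (R.-‿inverseˡ x)) (R.+-identityˡ y))
    -y+[x+y]≈x : - y + (x + y) R.≈ x
    -y+[x+y]≈x = R.trans (R.+-congˡ (R.+-comm x y)) (drop y x)

  ·½-step : ∀ n → n · ½ < suc n · ½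
  ·½-step n = <-respʳ-≈ (R.+-comm (n · ½) ½) (x<x+pos (n · ½) 0<½)

  ·½-mono-≤ : ∀ {m n} → m ℕ.≤ n → m · ½ ≤ʳ n · ½
  ·½-mono-≤ {zero}  {zero}  z≤n = ≤-refl
  ·½-mono-≤ {zero}  {suc n} z≤n = ≤-trans (·½-mono-≤ {zero} {n} z≤n) (<⇒≤ (·½-step n))
  ·½-mono-≤ {suc m} {suc n} (s≤s m≤n) lt =
    ·½-mono-≤ m≤n (+-cancelʳ-< ½ (<-respˡ-≈ (R.+-comm ½ _) (<-respʳ-≈ (R.+-comm ½ _) lt)))

  ·½-mono-< : ∀ {m n} → m ℕ.< n → m · ½ < n · ½
  ·½-mono-< {m} m<n = <-≤-trans (·½-step m) (·½-mono-≤ m<n)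

  half-mono-< : ∀ {a b} → a ℤ.< b → half a < half b
  half-mono-< (-<- n<m) = neg-mono-< (·½-mono-< (s≤s n<m))
  half-mono-< (+<+ m<n) = ·½-mono-< m<n
  half-mono-< (-<+ {m} {n}) =
    <-≤-trans (<-respʳ-≈ -0#≈0# (neg-mono-< (·½-mono-< {0} {suc m} (s≤s z≤n)))) (·½-mono-≤ {0} {n} z≤n)

  half-mono-≤ : ∀ {a b} → a ℤ.≤ b → half a ≤ʳ half b
  half-mono-≤ {a} {b} a≤b with a ℤ.≟ b
  ... | yes refl = ≤-refl
  ... | no a≢b   = <⇒≤ (half-mono-< (ℤ.≤∧≢⇒< a≤b a≢b))

  half-cancel-< : ∀ {a b} → half a < half b → a ℤ.< b
  half-cancel-< {a} {b} lt with a ℤ.<? b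
  ... | yes a<b = a<b
  ... | no a≮b  = contradiction lt (half-mono-≤ (ℤ.≮⇒≥ a≮b))

  half-<-suc : ∀ a → half a < half (ℤ.suc a)
  half-<-suc a = half-mono-< (ℤ.suc[i]≤j⇒i<j {a} ℤ.≤-refl)

  ⊲⇒≤ : ∀ a {b} → a ⊲ b → half a + 1# ≤ʳ half b
  ⊲⇒≤ a a⊲b = ≤-trans (≈⇒≤ (R.sym (half-+1 a))) (half-mono-≤ a⊲b)

  share⇒near : ∀ {a b p} → half a < p × p < half a + 1# → half b < p × p < half b + 1# → Near a b
  share⇒near {a} {b} (a<p , p<a+1) (b<p , p<b+1) = close⇒near
    (half-cancel-< (<-respʳ-≈ (R.sym (half-+1 b)) (<-trans a<p p<b+1)))
    (half-cancel-< (<-respʳ-≈ (R.sym (half-+1 a)) (<-trans b<p p<a+1)))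

  ⊲⇒¬share : ∀ {a b p} → a ⊲ b → ¬ ((half a < p × p < half a + 1#) × (half b < p × p < half b + 1#))
  ⊲⇒¬share {a} a⊲b ((_ , p<a+1) , (b<p , _)) = <-irrefl (<-trans b<p (<-≤-trans p<a+1 (⊲⇒≤ a a⊲b)))

  module Bands {n} (X Y : Fin n → ℤ) where
    open Visibility ℝ

    x y : Fin n → Carrier
    x = half ∘ X
    y = half ∘ Y

    Inside : (Fin n → ℤ) → Fin n → Carrier → Set ℓ₂
    Inside Z v p = half (Z v) < p × p < half (Z v) + 1#

    Band : Fin n → Fin n → Set (c ⊔ ℓ₂)
    Band = HorizontalBand x y

    band-sym : ∀ {v w} → Band v w → Band w v
    band-sym (a , b , a<b , inside) = a , b , a<b , λ q a<q q<b →
      let v∈ , w∈ , clear = inside q a<q q<b in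
      w∈ , v∈ , λ p between u u≢w u≢v → clear p (Sum.swap between) u u≢v u≢w

    band⇒near : ∀ {v w} → Band v w → Near (Y v) (Y w)
    band⇒near (a , b , a<b , inside) =
      let q , a<q , q<b = dense a<b
          (_ , _ , v∈) , (_ , _ , w∈) , _ = inside q a<q q<b
      in share⇒near v∈ w∈

    -- Having the height of `v` or of `w`, the square `u` meets every line that meets both.
    blocked : ∀ {v w u} → u ≢ v → u ≢ w → Y u ≡ Y v ⊎ Y u ≡ Y w →
              X v ⊲ X u → X u ⊲ X w → ¬ Band v w
    blocked {v} {w} {u} u≢v u≢w same v⊲u u⊲w (a , b , a<b , inside) =
      let q , a<q , q<b = dense a<b
          (_ , _ , v∈) , (_ , _ , w∈) , clear = inside q a<q q<b
          p , u<p , p<u+1 = unit-dense (x u)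
      in clear p (inj₁ (≤-trans (⊲⇒≤ (X v) v⊲u) (<⇒≤ u<p) , ≤-trans (<⇒≤ p<u+1) (⊲⇒≤ (X u) u⊲w)))
           u u≢v u≢w ((u<p , p<u+1) , covers q v∈ w∈ same)
      where
      covers : ∀ q → y v < q × q < y v + 1# → y w < q × q < y w + 1# → Y u ≡ Y v ⊎ Y u ≡ Y w →
               y u < q × q < y u + 1#
      covers q v∈ w∈ (inj₁ eq) = subst (λ z → half z < q × q < half z + 1#) (sym eq) v∈
      covers q v∈ w∈ (inj₂ eq) = subst (λ z → half z < q × q < half z + 1#) (sym eq) w∈

    Outside : Fin n → Fin n → Fin n → Set
    Outside u v w = (X u ⊲ X v × X u ⊲ X w) ⊎ (X v ⊲ X u × X w ⊲ X u)

    -- S_v covers the strip of height ½ above level k.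
    Covers : ℤ → Fin n → Set
    Covers k v = k ≡ Y v ⊎ k ≡ ℤ.suc (Y v)

    -- As heights are half-integral, a strip of height ½ is either covered by a square or disjoint
    -- from its interior, so one strip decides.
    band : ∀ {v w} k → Covers k v → Covers k w →
           (∀ u → u ≢ v → u ≢ w → Covers k u → Outside u v w) → Band v w
    band {v} {w} k cv cw outside =
      half k , half (ℤ.suc k) , half-<-suc k , λ q k<q q<k+1 →
      (let p , p∈ = unit-dense (x v) in p , p∈ , fits cv k<q q<k+1) ,
      (let p , p∈ = unit-dense (x w) in p , p∈ , fits cw k<q q<k+1) ,
      λ p between u u≢v u≢w ((u<p , p<u+1) , (u<q , q<u+1)) →
        hidden (outside u u≢v u≢w (within
          (<suc⇒≤ (half-cancel-< (<-trans u<q q<k+1)))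
          (<suc⇒≤ (half-cancel-< (<-respʳ-≈ (R.sym (half-+1 (Y u))) (<-trans k<q q<u+1))))))
          u<p p<u+1 between
      where
      fits : ∀ {v q} → Covers k v → half k < q → q < half (ℤ.suc k) → y v < q × q < y v + 1#
      fits {v} (inj₁ refl) k<q q<k+1 = k<q , <-trans q<k+1
        (<-respʳ-≈ (half-+1 (Y v)) (half-<-suc (ℤ.suc (Y v))))
      fits {v} (inj₂ refl) k<q q<k+1 =
        <-trans (half-<-suc (Y v)) k<q , <-respʳ-≈ (half-+1 (Y v)) q<k+1
      hidden : ∀ {u p} → Outside u v w → x u < p → p < x u + 1# → ¬ Between x y v w p
      hidden {u} (inj₁ (u⊲v , u⊲w)) u<p p<u+1 (inj₁ (v+1≤p , _)) =
        <-irrefl (<-trans (x<x+1 _) (≤-<-trans v+1≤p (<-≤-trans p<u+1 (⊲⇒≤ (X u) u⊲v))))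
      hidden {u} (inj₁ (u⊲v , u⊲w)) u<p p<u+1 (inj₂ (w+1≤p , _)) =
        <-irrefl (<-trans (x<x+1 _) (≤-<-trans w+1≤p (<-≤-trans p<u+1 (⊲⇒≤ (X u) u⊲w))))
      hidden {u} (inj₂ (v⊲u , w⊲u)) u<p p<u+1 (inj₁ (_ , p≤w)) =
        <-irrefl (<-trans (x<x+1 _) (≤-<-trans (⊲⇒≤ (X w) w⊲u) (<-≤-trans u<p p≤w)))
      hidden {u} (inj₂ (v⊲u , w⊲u)) u<p p<u+1 (inj₂ (_ , p≤v)) =
        <-irrefl (<-trans (x<x+1 _) (≤-<-trans (⊲⇒≤ (X v) v⊲u) (<-≤-trans u<p p≤v)))

-- Visibility in the drawing

⊲-irrefl : ∀ x → ¬ x ⊲ x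
⊲-irrefl x x⊲x = ℤ.<-irrefl refl (ℤ.<-trans (ℤ.suc[i]≤j⇒i<j {x} ℤ.≤-refl) (ℤ.suc[i]≤j⇒i<j x⊲x))

beyond-irrefl : ∀ b x → ¬ Beyond b x x
beyond-irrefl false = ⊲-irrefl
beyond-irrefl true  = ⊲-irrefl

beyond-flip : ∀ b {x y} → Beyond b x y → Beyond (not b) y x
beyond-flip false x⊲y = x⊲y
beyond-flip true  x⊲y = x⊲y

data Child : Word → Word → Set where
  child : ∀ {ℓ u} → Child u (ℓ ∷ u)

Related : Word → Word → Set
Related v w = Child v w ⊎ Child w v

spine-related : ∀ d r z → Related (spine d r z) (spine d r (ℤ.suc z))
spine-related d r (+ n)         = inj₁ child
spine-related d r -[1+ zero ]   = inj₂ child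
spine-related d r -[1+ suc n ]  = inj₂ child

legs-suffix : ∀ d r z {i j} → i ≤ j → ∃[ p ] build d r z j ≡ p ++ build d r z i
legs-suffix d r z = go ∘ ℕ.≤⇒≤′
  where
  go : ∀ {i j} → i ℕ.≤′ j → ∃[ p ] build d r z j ≡ p ++ build d r z i
  go (ℕ.≤′-reflexive refl) = [] , refl
  go (ℕ.≤′-step i≤j) = let p , eq = go i≤j in (d , leg) ∷ p , cong ((d , leg) ∷_) eq

module Drawing (s : ℕ) where
  open Position s

  Vertex : Set
  Vertex = Fin (length (words s []))

  vert : Vertex → Word
  vert = lookup (words s [])

  vert-injective : ∀ {a b} → vert a ≡ vert b → a ≡ b
  vert-injective = lookup-unique (words-unique s [])

  at : ∀ {w} → w ∈ words s [] → ∃[ a ] vert a ≡ w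
  at w∈ = index w∈ , sym (lookup-index w∈)

  module Along (d : Dir) {c ℓ₁ ℓ₂} (ℝ : Reals c ℓ₁ ℓ₂) where
    X Y : Vertex → ℤ
    X = pos (opp d) ∘ vert
    Y = pos d ∘ vert

    open HalfIntegers ℝ
    open Bands X Y public

    record At (a : Vertex) (r : Word) (z : ℤ) (i : ℕ) : Set where
      constructor at-slot
      field
        isRoot : RowRoot d r
        word≡  : vert a ≡ build d r z i
    open At

    data Place (a : Vertex) : Set where
      place : ∀ r z i → At a r z i → Place a

    placeOf : ∀ a → Place a
    placeOf a with slotOf s d (vert a) (∈-lookup a)
    ... | slot rr z i eq = place _ z i (at-slot rr eq)

    private variable
      a b u v w : Vertex
      r r′ : Word
      z z′ : ℤ
      i j : ℕ

    At-unique : At a r z i → At b r z i → a ≡ b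
    At-unique pa pb = vert-injective (trans (word≡ pa) (sym (word≡ pb)))

    index≤s : At a r z i → ∣ z ∣ ≤ s
    index≤s {a} {r} {z} {i} pa = ℕ.≤-trans (length-build d r z i)
      (subst (λ w → length w ≤ s) (word≡ pa) (words-length s (∈-lookup a)))

    height : At a r z i → Y a ≡ z ℤ.+ pos d r
    height {r = r} {z} {i} pa = trans (cong (pos d) (word≡ pa)) (pos-build d r z i)

    near⇒same-row : At a r z i → At b r′ z′ j → Near (Y a) (Y b) → r ≡ r′
    near⇒same-row {z = z} {i} {z′ = z′} {j} pa pb near =
      same-row (isRoot pa) (isRoot pb) z z′ (index≤s pa) (index≤s pb) i j
        (subst₂ Near (cong (pos d) (word≡ pa)) (cong (pos d) (word≡ pb)) near)

    height-≡ : At a r z i → At b r z′ j → Y a ≡ Y b → z ≡ z′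
    height-≡ {r = r} {z} {z′ = z′} pa pb eq =
      ∙-cancelʳ (pos d r) z z′ (trans (sym (height pa)) (trans eq (height pb)))

    height-suc : At a r z i → At b r z′ j → Y a ≡ ℤ.suc (Y b) → z ≡ ℤ.suc z′
    height-suc {r = r} {z} {z′ = z′} pa pb eq =
      suc-cancel {z} {z′} (pos d r) (trans (sym (height pa)) (trans eq (cong ℤ.suc (height pb))))

    near⇒near : At a r z i → At b r z′ j → Near (Y a) (Y b) → Near z z′
    near⇒near pa pb = Sum.map (height-≡ pa pb) (Sum.map (height-suc pb pa) (height-suc pa pb))

    legs-apart : At a r z i → At b r z j → i ℕ.< j → Beyond (odd ∣ z ∣) (X a) (X b)
    legs-apart {z = z} pa pb i<j =
      subst₂ (Beyond (odd ∣ z ∣)) (sym (cong (pos (opp d)) (word≡ pa))) (sym (cong (pos (opp d)) (word≡ pb)))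
        (legs-beyond (isRoot pa) z i<j)

    parity-apart : At a r z i → At b r z′ j → odd ∣ z′ ∣ ≡ not (odd ∣ z ∣) →
                   Beyond (not (odd ∣ z ∣)) (X a) (X b)
    parity-apart {z = z} {i} {z′ = z′} {j} pa pb eq =
      subst₂ (Beyond (not (odd ∣ z ∣))) (sym (cong (pos (opp d)) (word≡ pa))) (sym (cong (pos (opp d)) (word≡ pb)))
        (opposite (isRoot pa) z i z′ j eq)

    odd-pred : ∀ z → odd ∣ z ∣ ≡ not (odd ∣ ℤ.suc z ∣)
    odd-pred z = sym (trans (cong not (odd-suc z)) (not-involutive _))

    beyond⇒≢ : ∀ b → Beyond b (X u) (X v) → u ≢ v
    beyond⇒≢ b far refl = beyond-irrefl b _ far

    outside-in : ∀ b → Beyond b (X u) (X v) → Beyond b (X u) (X w) → Outside u v w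
    outside-in false far far′ = inj₂ (far , far′)
    outside-in true  far far′ = inj₁ (far , far′)

    outside-out : ∀ b → Beyond b (X v) (X u) → Beyond b (X w) (X u) → Outside u v w
    outside-out false far far′ = inj₁ (far , far′)
    outside-out true  far far′ = inj₂ (far , far′)

    blocked-between : ∀ b → Beyond b (X v) (X u) → Beyond b (X u) (X w) →
                      Y u ≡ Y v ⊎ Y u ≡ Y w → ¬ Band v w
    blocked-between {v} {u} {w} false far far′ same =
      blocked (beyond⇒≢ {u} {w} false far′) (beyond⇒≢ {v} {u} false far ∘ sym) (Sum.swap same) far′ far
      ∘ band-sym {v} {w}
    blocked-between {v} {u} {w} true  far far′ same =
      blocked (beyond⇒≢ {v} {u} true far ∘ sym) (beyond⇒≢ {u} {w} true far′) same far far′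

    -- The lower half of a rung is shared only with the rung below. Squares of the same rung are
    -- ordered by leg index; those of the rung below all lie on the opposite side.
    legs-band : At a r z j → At b r z (suc j) → Band a b
    legs-band {a} {r} {z} {j} {b} pa pb =
      band {a} {b} (Y a) (inj₁ refl) (inj₁ (trans (height pa) (sym (height pb)))) outside
      where
      outside : ∀ u → u ≢ a → u ≢ b → Covers (Y a) u → Outside u a b
      outside u u≢a u≢b cu with placeOf u
      ... | place _ z′ i pu with near⇒same-row pa pu ([ inj₁ , inj₂ ∘ inj₂ ]′ cu)
      ...   | refl with cu
      ...     | inj₁ eq with height-≡ pa pu eq
      ...       | refl with ℕ.<-cmp i j
      ...         | tri< i<j _ _  = outside-in {u} {a} {b} (odd ∣ z ∣) (legs-apart pu pa i<j) (legs-apart pu pb (ℕ.m≤n⇒m≤1+n i<j))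
      ...         | tri≈ _ refl _ = contradiction (At-unique pu pa) u≢a
      ...         | tri> _ _ j<i with ℕ.m≤n⇒m<n∨m≡n j<i
      ...           | inj₁ 1+j<i = outside-out {a} {u} {b} (odd ∣ z ∣) (legs-apart pa pu j<i) (legs-apart pb pu 1+j<i)
      ...           | inj₂ refl  = contradiction (At-unique pu pb) u≢b
      outside u u≢a u≢b cu | place _ z′ i pu | refl | inj₂ eq with height-suc pa pu eq
      ... | refl = outside-out {a} {u} {b} (not (odd ∣ z ∣)) (parity-apart pa pu (odd-pred z′)) (parity-apart pb pu (odd-pred z′))

    -- In the half strip common to two successive rungs the two spine squares are innermost, with
    -- each leg farther out on its own side.
    spine-band : At a r z 0 → At b r (ℤ.suc z) 0 → Band a b
    spine-band {a} {r} {z} {b} pa pb = band {a} {b} (Y b) (inj₂ above) (inj₁ refl) outside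
      where
      above : Y b ≡ ℤ.suc (Y a)
      above = trans (height pb) (trans (ℤ.+-assoc (+ 1) z (pos d r)) (cong ℤ.suc (sym (height pa))))
      upper : ∀ {u} i → u ≢ b → At u r (ℤ.suc z) i → Outside u a b
      upper     zero    u≢b pu = contradiction (At-unique pu pb) u≢b
      upper {u} (suc i) u≢b pu = outside-out {a} {u} {b} (not (odd ∣ z ∣)) (parity-apart pa pu (odd-suc z))
        (subst (λ p → Beyond p (X b) (X u)) (odd-suc z) (legs-apart pb pu (s≤s z≤n)))
      lower : ∀ {u} i → u ≢ a → At u r z i → Outside u a b
      lower     zero    u≢a pu = contradiction (At-unique pu pa) u≢a
      lower {u} (suc i) u≢a pu = outside-out {a} {u} {b} (odd ∣ z ∣) (legs-apart pa pu (s≤s z≤n))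
        (subst (λ p → Beyond p (X b) (X u)) (sym (odd-pred z)) (parity-apart pb pu (odd-pred z)))
      outside : ∀ u → u ≢ a → u ≢ b → Covers (Y b) u → Outside u a b
      outside u u≢a u≢b cu with placeOf u
      ... | place _ z′ i pu with near⇒same-row pb pu ([ inj₁ , inj₂ ∘ inj₂ ]′ cu)
      ...   | refl with cu
      ...     | inj₁ eq = upper i u≢b (subst (λ z → At u r z i) (sym (height-≡ pb pu eq)) pu)
      ...     | inj₂ eq = lower i u≢a (subst (λ z → At u r z i) (sym (suc-injective (height-suc pb pu eq))) pu)
        where
        suc-injective : ∀ {x y} → ℤ.suc x ≡ ℤ.suc y → x ≡ y
        suc-injective {x} {y} eq = trans (sym (ℤ.pred-suc x)) (trans (cong ℤ.pred eq) (ℤ.pred-suc y))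

    child⇒band : ∀ k → vert b ≡ (d , k) ∷ vert a → Band a b
    child⇒band {b} {a} k vb with placeOf b
    ... | place _ z (suc j) pb =
      legs-band (at-slot (isRoot pb) (List.∷-injectiveʳ (trans (sym vb) (word≡ pb)))) pb
    ... | place _ (+ suc n) 0 pb =
      spine-band {z = + n} (at-slot (isRoot pb) (List.∷-injectiveʳ (trans (sym vb) (word≡ pb)))) pb
    -- On negative rungs the parent is the upper of the two squares, so the band is taken with the
    -- roles exchanged.
    ... | place _ -[1+ zero ] 0 pb = band-sym {b} {a}
      (spine-band pb (at-slot {z = + 0} (isRoot pb) (List.∷-injectiveʳ (trans (sym vb) (word≡ pb)))))
    ... | place _ -[1+ suc n ] 0 pb = band-sym {b} {a}
      (spine-band pb (at-slot {z = -[1+ n ]} (isRoot pb) (List.∷-injectiveʳ (trans (sym vb) (word≡ pb)))))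
    ... | place _ (+ zero) 0 pb = contradiction (trans (sym (word≡ pb)) vb) (across (isRoot pb))
      where
      across : ∀ {r ℓ u} → RowRoot d r → r ≢ (d , ℓ) ∷ u
      across turned eq = opp≢ d (cong proj₁ (List.∷-injectiveˡ eq))

    ancestor : At a r z j → i ≤ j → ∃[ u ] At u r z i
    ancestor {a} {r} {z} pa i≤j =
      let p , eq = legs-suffix d r z i≤j
          u , vu = at (words-suffix s p (subst (_∈ words s []) (trans (word≡ pa) eq) (∈-lookup a)))
      in u , at-slot (isRoot pa) vu

    -- Unless the indices are consecutive, the square following `a` on the leg blocks the view.
    same-leg⇒related : At a r z i → At b r z j → i ℕ.< j → Band a b → Related (vert a) (vert b)
    same-leg⇒related {a} {r} {z} {i} {b} {j} pa pb i<j ab with ℕ.m≤n⇒m<n∨m≡n i<j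
    ... | inj₂ refl = inj₁ (subst₂ Child (sym (word≡ pa)) (sym (word≡ pb)) child)
    ... | inj₁ 1+i<j =
      let u , pu = ancestor pb (ℕ.<⇒≤ 1+i<j) in
      contradiction ab (blocked-between {a} {u} {b} (odd ∣ z ∣)
        (legs-apart pa pu (ℕ.n<1+n i)) (legs-apart pu pb 1+i<j)
        (inj₁ (trans (height pu) (sym (height pa)))))

    -- The view from a leg square to the neighbouring rung is blocked by the spine square of its own
    -- rung.
    next-spine⇒related : ∀ i j → At a r z i → At b r (ℤ.suc z) j → Band a b → Related (vert a) (vert b)
    next-spine⇒related {r = r} {z} zero zero pa pb ab =
      subst₂ Related (sym (word≡ pa)) (sym (word≡ pb)) (spine-related d r z)
    next-spine⇒related {a = a} {z = z} {b} (suc i) j pa pb ab =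
      let u , pu = ancestor {i = 0} pa z≤n in
      contradiction ab (blocked-between {a} {u} {b} (not (odd ∣ z ∣))
        (beyond-flip (odd ∣ z ∣) {X u} {X a} (legs-apart pu pa (s≤s z≤n)))
        (parity-apart pu pb (odd-suc z))
        (inj₁ (trans (height pu) (sym (height pa)))))
    next-spine⇒related {a = a} {z = z} {b} zero (suc j) pa pb ab =
      let u , pu = ancestor {i = 0} pb z≤n in
      contradiction (band-sym {a} {b} ab) (blocked-between {b} {u} {a} (not (odd ∣ ℤ.suc z ∣))
        (beyond-flip (odd ∣ ℤ.suc z ∣) {X u} {X b} (legs-apart pu pb (s≤s z≤n)))
        (parity-apart pu pa (odd-pred z))
        (inj₁ (trans (height pu) (sym (height pb)))))

    band⇒related : a ≢ b → Band a b → Related (vert a) (vert b)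
    band⇒related {a} {b} a≢b ab with placeOf a | placeOf b
    ... | place _ z i pa | place _ z′ j pb with near⇒same-row pa pb (band⇒near {a} {b} ab)
    ...   | refl with near⇒near pa pb (band⇒near {a} {b} ab)
    ...     | inj₂ (inj₁ refl) = next-spine⇒related i j pa pb ab
    ...     | inj₂ (inj₂ refl) = Sum.swap (next-spine⇒related j i pb pa (band-sym {a} {b} ab))
    ...     | inj₁ refl with ℕ.<-cmp i j
    ...       | tri< i<j _ _  = same-leg⇒related pa pb i<j ab
    ...       | tri≈ _ refl _ = contradiction (At-unique pa pb) a≢b
    ...       | tri> _ _ j<i  = Sum.swap (same-leg⇒related pb pa j<i (band-sym {a} {b} ab))

    beyond⇒¬share : ∀ b {u v p} → Beyond b (X u) (X v) → ¬ (Inside X u p × Inside X v p)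
    beyond⇒¬share false {u} {v} far (u∈ , v∈) = ⊲⇒¬share {X v} {X u} far (v∈ , u∈)
    beyond⇒¬share true  {u} {v} far (u∈ , v∈) = ⊲⇒¬share {X u} {X v} far (u∈ , v∈)

    disjoint : a ≢ b → ∀ {p q} → Inside X a p → Inside Y a q → Inside X b p → Inside Y b q → ⊥
    disjoint {a} {b} a≢b {p} {q} xa ya xb yb with placeOf a | placeOf b
    ... | place _ z i pa | place _ z′ j pb with near⇒same-row pa pb (share⇒near {Y a} {Y b} ya yb)
    ...   | refl with near⇒near pa pb (share⇒near {Y a} {Y b} ya yb)
    ...     | inj₂ (inj₁ refl) = beyond⇒¬share (not (odd ∣ z ∣)) {a} {b} (parity-apart pa pb (odd-suc z)) (xa , xb)
    ...     | inj₂ (inj₂ refl) = beyond⇒¬share (not (odd ∣ z′ ∣)) {b} {a} (parity-apart pb pa (odd-suc z′)) (xb , xa)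
    ...     | inj₁ refl with ℕ.<-cmp i j
    ...       | tri< i<j _ _  = beyond⇒¬share (odd ∣ z ∣) {a} {b} (legs-apart pa pb i<j) (xa , xb)
    ...       | tri≈ _ refl _ = a≢b (At-unique pa pb)
    ...       | tri> _ _ j<i  = beyond⇒¬share (odd ∣ z ∣) {b} {a} (legs-apart pb pa j<i) (xb , xa)

-- The extremal tree as a graph

child-length : ∀ {u w} → Child u w → length w ≡ suc (length u)
child-length child = refl

child-unique : ∀ {u v w} → Child u w → Child v w → u ≡ v
child-unique child child = refl

child? : ∀ u w → Dec (Child u w)
child? u []      = no λ ()
child? u (ℓ ∷ w) with List.≡-dec _≟ˡ_ u w
... | yes refl = yes child
... | no u≢w   = no λ { child → u≢w refl }

child-irrefl : ∀ {w} → ¬ Child w w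
child-irrefl c = contradiction (child-length c) (ℕ.<⇒≢ (ℕ.n<1+n _))

module ExtremalTree (s : ℕ) where
  open Drawing s

  tree : Graph (length (words s []))
  tree = record
    { Adj    = λ a b → Related (vert a) (vert b)
    ; adj?   = λ a b → child? (vert a) (vert b) ⊎-dec child? (vert b) (vert a)
    ; symm   = Sum.swap
    ; irrefl = λ { refl → [ child-irrefl , child-irrefl ]′ }
    }

  open Graph tree

  rootAt : ∃[ a ] vert a ≡ []
  rootAt = at (words-root s)

  root₀ : Vertex
  root₀ = proj₁ rootAt

  _∷ʳʷ_ : ∀ {a b c k} → Walk tree a b k → Adj b c → Walk tree a c (suc k)
  []      ∷ʳʷ e = e ∷ []
  (f ∷ p) ∷ʳʷ e = f ∷ (p ∷ʳʷ e)

  appendWalk : ∀ {a b c j k} → Walk tree a b j → Walk tree b c k → Walk tree a c (j ℕ.+ k)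
  appendWalk []      q = q
  appendWalk (e ∷ p) q = e ∷ appendWalk p q

  walkBack : ∀ {a b k} → Walk tree a b k → Walk tree b a k
  walkBack []      = []
  walkBack (e ∷ p) = walkBack p ∷ʳʷ symm e

  fromRoot : ∀ a → Walk tree root₀ a (length (vert a))
  fromRoot a = go (vert a) a refl
    where
    go : ∀ w a → vert a ≡ w → Walk tree root₀ a (length w)
    go []      a va = subst (λ b → Walk tree root₀ b 0) (vert-injective (trans (proj₂ rootAt) (sym va))) []
    go (ℓ ∷ u) a va =
      let b , vb = at (proj₂ (words-tail s (subst (_∈ words s []) va (∈-lookup a)))) in
      go u b vb ∷ʳʷ inj₁ (subst₂ Child (sym vb) (sym va) child)

  connected : Connected tree
  connected a b = _ , appendWalk (walkBack (fromRoot a)) (fromRoot b)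

  walk-length : ∀ {a b k} → Walk tree a b k → length (vert b) ≤ length (vert a) ℕ.+ k
  walk-length {a} [] = ℕ.m≤m+n _ 0
  walk-length {a} {k = suc k} (inj₁ c ∷ p) = ℕ.≤-trans (walk-length p)
    (ℕ.≤-reflexive (trans (cong (ℕ._+ k) (child-length c)) (sym (ℕ.+-suc _ k))))
  walk-length {a} {k = suc k} (inj₂ c ∷ p) = ℕ.≤-trans (walk-length p)
    (ℕ.+-mono-≤ (ℕ.≤-trans (ℕ.n≤1+n _) (ℕ.≤-reflexive (sym (child-length c)))) (ℕ.n≤1+n k))

  distance : ∀ a → Distance tree root₀ a (length (vert a))
  distance a = fromRoot a , λ k p →
    subst (λ w → length (vert a) ≤ length w ℕ.+ k) (proj₂ rootAt) (walk-length p)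

  depth : Depth tree root₀ s
  depth = (let a , va = deepest in a , subst (Distance tree root₀ a) (trans (cong length va) (List.length-replicate s)) (distance a)) ,
    λ k (a , _ , min) → ℕ.≤-trans (min _ (fromRoot a)) (words-length s (∈-lookup a))
    where
    deepest : ∃[ a ] vert a ≡ replicate s (H , leg)
    deepest = at (subst (_∈ words s []) (List.++-identityʳ _) (replicate-leg s 0))

  -- The vertices after x on a non-backtracking walk that came to x from p.
  data Trail : Vertex → Vertex → List Vertex → Set where
    rest   : ∀ {p x} → Trail p x []
    onward : ∀ {p x y ys} → Adj x y → y ≢ p → Trail x y ys → Trail p x (y ∷ ys)

  final : Vertex → List Vertex → Vertex
  final x []       = x
  final x (y ∷ ys) = final y ys

  penultimate : Vertex → Vertex → List Vertex → Vertex
  penultimate p x []       = p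
  penultimate p x (y ∷ ys) = penultimate x y ys

  final-∷ʳ : ∀ x ys e → final x (ys ∷ʳ e) ≡ e
  final-∷ʳ x []       e = refl
  final-∷ʳ x (y ∷ ys) e = final-∷ʳ y ys e

  penultimate-∷ʳ : ∀ p x ys e → penultimate p x (ys ∷ʳ e) ≡ final x ys
  penultimate-∷ʳ p x []       e = refl
  penultimate-∷ʳ p x (y ∷ ys) e = penultimate-∷ʳ x y ys e

  final-∈ : ∀ x ys → final x ys ∈ x ∷ ys
  final-∈ x []       = here refl
  final-∈ x (y ∷ ys) = there (final-∈ y ys)

  -- Parents are unique, so a non-backtracking walk that has stepped down can never step up again.
  trail-down : ∀ {p x ys} → Child (vert p) (vert x) → Trail p x ys →
               length (vert p) ℕ.< length (vert (final x ys)) ×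
               Child (vert (penultimate p x ys)) (vert (final x ys))
  trail-down c rest = ℕ.≤-reflexive (sym (child-length c)) , c
  trail-down c (onward (inj₁ c′) _ t) = let lt , last = trail-down c′ t in
    ℕ.<-trans (ℕ.≤-reflexive (sym (child-length c))) lt , last
  trail-down c (onward (inj₂ c′) y≢p t) = contradiction (vert-injective (child-unique c′ c)) y≢p

  trail-up : ∀ {p x ys} → Child (vert x) (vert p) → Trail p x ys →
             length (vert (final x ys)) ℕ.< length (vert p) ⊎
             Child (vert (penultimate p x ys)) (vert (final x ys))
  trail-up c rest = inj₁ (ℕ.≤-reflexive (sym (child-length c)))
  trail-up c (onward (inj₁ c′) _ t) = inj₂ (proj₂ (trail-down c′ t))
  trail-up c (onward (inj₂ c′) _ t) =
    Sum.map₁ (λ lt → ℕ.<-trans lt (ℕ.≤-reflexive (sym (child-length c)))) (trail-up c′ t)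

  toTrail : ∀ p x ys e → Linked Adj (x ∷ (ys ∷ʳ e)) → Unique (p ∷ x ∷ ys) → All (e ≢_) (p ∷ x ∷ ys) →
            Trail p x (ys ∷ʳ e)
  toTrail p x [] e (xe ∷ _) _ (e≢p ∷ _) = onward xe e≢p rest
  toTrail p x (y ∷ ys) e (xy ∷ l) ((_ ∷ p≢y ∷ _) ∷ u) (_ ∷ ne) =
    onward xy (λ y≡p → p≢y (sym y≡p)) (toTrail x y ys e l u ne)

  -- A closed trail starting downwards would end at a longer word. One starting upwards would end at
  -- a shorter word, or return to `v` from its parent, which is `a` again.
  acyclic : ∀ v vs → ¬ IsCycle tree v vs
  acyclic v (a ∷ b ∷ cs) (_ , (v∉@(_ ∷ v≢b ∷ _) ∷ u@(a∉ ∷ _)) , (va ∷ ab ∷ l)) = turn-back va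
    where
    trail : Trail v a (b ∷ (cs ∷ʳ v))
    trail = onward ab (λ b≡v → v≢b (sym b≡v)) (toTrail a b cs v l u v∉)
    shorter : ¬ (length (vert (final b (cs ∷ʳ v))) ℕ.< length (vert v))
    shorter lt = ℕ.<-irrefl refl (subst (λ w → length (vert w) ℕ.< length (vert v)) (final-∷ʳ b cs v) lt)
    turn-back : ¬ Adj v a
    turn-back (inj₁ c) = ℕ.<-irrefl refl
      (subst (λ w → length (vert v) ℕ.< length (vert w)) (final-∷ʳ b cs v) (proj₁ (trail-down c trail)))
    turn-back (inj₂ c) with trail-up c trail
    ... | inj₁ lt = shorter lt
    ... | inj₂ c′ = All.lookup a∉ (subst (_∈ b ∷ cs) (trans (sym (penultimate-∷ʳ a b cs v)) same) (final-∈ b cs)) refl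
      where
      same : penultimate a b (cs ∷ʳ v) ≡ a
      same = vert-injective (child-unique
        (subst (λ w → Child (vert (penultimate a b (cs ∷ʳ v))) (vert w)) (final-∷ʳ b cs v) c′) c)
  acyclic v []       (() , _)
  acyclic v (_ ∷ []) (s≤s () , _)

  isTree : IsTree tree
  isTree = connected , acyclic

module TreeSize (d : ℕ) where
  open Drawing (suc d)
  open ExtremalTree (suc d)
  open Graph tree

  private
    -- The root is listed first, at index `zero`, so each `suc i` contributes the edge to its
    -- parent.
    parent : ∀ i → ∃[ a ] Child (vert a) (vert (suc i))
    parent i with vert (suc i) in eq
    ... | [] = contradiction (vert-injective {suc i} {zero} eq) λ ()
    ... | ℓ ∷ u =
      let a , va = at (proj₂ (words-tail (suc d) (subst (_∈ words (suc d) []) eq (∈-lookup (suc i))))) in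
      a , subst (λ w → Child w (ℓ ∷ u)) (sym va) child

    edge : ∀ i → Vertex × Vertex
    edge i = upward (proj₁ (parent i) , suc i)

    edge-cases : ∀ i → let a = proj₁ (parent i) in
                 (a Fin.< suc i × edge i ≡ (a , suc i)) ⊎ (suc i Fin.< a × edge i ≡ (suc i , a))
    edge-cases i with Fin.<-cmp (proj₁ (parent i)) (suc i)
    ... | tri< lt _ _ = inj₁ (lt , upward-id lt)
    ... | tri≈ _ eq _ = contradiction (subst (λ b → Child (vert b) (vert (suc i))) eq (proj₂ (parent i))) child-irrefl
    ... | tri> _ _ gt = inj₂ (gt , upward-swap gt)

    crossed : ∀ {i j} → proj₁ (parent i) ≡ suc j → suc i ≢ proj₁ (parent j)
    crossed {i} {j} eq eq′ = ℕ.<-asym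
      (ℕ.≤-reflexive (sym (child-length (subst (λ a → Child (vert a) (vert (suc i))) eq (proj₂ (parent i))))))
      (ℕ.≤-reflexive (sym (child-length (subst (λ a → Child (vert a) (vert (suc j))) (sym eq′) (proj₂ (parent j))))))

    edge-injective : ∀ {i j} → edge i ≡ edge j → i ≡ j
    edge-injective {i} {j} eq with edge-cases i | edge-cases j
    ... | inj₁ (_ , ei) | inj₁ (_ , ej) = Fin.suc-injective (cong proj₂ (trans (sym ei) (trans eq ej)))
    ... | inj₂ (_ , ei) | inj₂ (_ , ej) = Fin.suc-injective (cong proj₁ (trans (sym ei) (trans eq ej)))
    ... | inj₁ (_ , ei) | inj₂ (_ , ej) = contradiction (cong proj₂ both) (crossed (cong proj₁ both))
      where both = trans (sym ei) (trans eq ej)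
    ... | inj₂ (_ , ei) | inj₁ (_ , ej) = contradiction (cong proj₁ both) (crossed (cong proj₂ both))
      where both = trans (sym ei) (trans eq ej)

    counted : ∀ i → proj₁ (edge i) Fin.< proj₂ (edge i) × Adj (proj₁ (edge i)) (proj₂ (edge i))
    counted i with edge-cases i
    ... | inj₁ (lt , ei) rewrite ei = lt , inj₁ (proj₂ (parent i))
    ... | inj₂ (gt , ei) rewrite ei = gt , inj₂ (proj₂ (parent i))

  maxEdges≤edgeCount : maxEdges (suc d) ≤ edgeCount tree
  maxEdges≤edgeCount = ℕ.≤-trans
    (ℕ.≤-reflexive (trans (sym (ℕ.suc-injective (length-all-words (suc d)))) (sym (List.length-tabulate edge))))
    (length≤edgeCount tree (Unique.tabulate⁺ edge-injective) λ e∈ →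
      let i , eq = ∈-tabulate⁻ e∈ in
      subst (λ e → proj₁ e Fin.< proj₂ e × Adj (proj₁ e) (proj₂ e)) (sym eq) (counted i))

-- Attaining the maximum

module _ {c ℓ₁ ℓ₂} (ℝ : Reals c ℓ₁ ℓ₂) where
  open Visibility ℝ

  maxEdges-attained : ∀ d → URVGTreeEdges (suc d) (maxEdges (suc d))
  maxEdges-attained d = _ , tree , root₀ , isTree , depth , drawn ,
    -- Only one inequality is counted on the tree itself; the other is the upper bound applied to
    -- this very drawing.
    ℕ.≤-antisym (upper-bound ℝ d _ (_ , tree , root₀ , isTree , depth , drawn , refl)) maxEdges≤edgeCount
    where
    open Drawing (suc d)
    open ExtremalTree (suc d)
    open TreeSize d
    module AlongH = Along H ℝ
    -- The coordinates are exchanged, so the horizontal bands of `AlongV` are the vertical bands of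
    -- the drawing.
    module AlongV = Along V ℝ
    seen : ∀ {a b} → Child (vert a) (vert b) →
           Visibility.HorizontalBand ℝ AlongH.x AlongH.y a b ⊎ Visibility.VerticalBand ℝ AlongH.x AlongH.y a b
    seen {a} {b} ab = by-letter (vert b) refl ab
      where
      by-letter : ∀ w → vert b ≡ w → Child (vert a) w → AlongH.Band a b ⊎ AlongV.Band a b
      by-letter ((H , k) ∷ _) vb child = inj₁ (AlongH.child⇒band k vb)
      by-letter ((V , k) ∷ _) vb child = inj₂ (AlongV.child⇒band k vb)
    drawn : IsURVG tree
    drawn = AlongH.x , AlongH.y ,
      (λ a b a≢b p q ((xa , ya) , (xb , yb)) → AlongH.disjoint a≢b xa ya xb yb) ,
      λ a b a≢b → mk⇔
        [ seen , (λ ba → Sum.map AlongH.band-sym AlongV.band-sym (seen ba)) ]′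
        [ AlongH.band⇒related a≢b , AlongV.band⇒related a≢b ]′

corollary6p3 : ∀ {c ℓ₁ ℓ₂ : Level} (ℝ : Reals c ℓ₁ ℓ₂) → let open Reals ℝ in
    (√17 : Carrier) (0<√17 : 0# < √17) → √17 * √17 ≈ fromℕ 17 →
    (s : ℕ) → 1 ≤ s →
    ∃[ N ] IsMaximum (Visibility.URVGTreeEdges ℝ s) N × fromℕ N ≈ closedForm √17 0<√17 s
corollary6p3 ℝ √17 0<√17 √17² (suc d) _ =
  maxEdges (suc d) , (maxEdges-attained ℝ d , upper-bound ℝ d) ,
  ClosedForm.maxEdges≈closedForm ℝ √17 0<√17 √17² (suc d)
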